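{- Let $k\ge 1$ and $r\ge 2$ be integers and let $d_1\ge d_2\ge\cdots\ge d_k$ be positive integers. Then for all sufficiently large $n$, $$ex^{lin}_r\Big(n,\bigcup_{i=1}^k S^+_{d_i}\Big)\le \max_{1\le i\le k}\left\{\Big(\frac{d_i-1}{r}+\frac{i-1}{r-1}\Big)(n-i+1)+\frac{\binom{i-1}{2}}{\binom{r}{2}}\right\}.$$ Moreover, this bound is sharp asymptotically.
   Context: An $r$-uniform hypergraph is linear if every two of its hyperedges share at most one vertex. For a linear $r$-uniform hypergraph $F$, $ex^{lin}_r(n,F)$ is the maximum number of hyperedges in an $n$-vertex $r$-uniform linear hypergraph containing no copy of $F$ as a subhypergraph. $S_\ell$ denotes the star $K_{1,\ell}$ with $\ell$ edges. For a graph $F$ and $r\ge 2$, the expansion $F^+$ is the $r$-uniform hypergraph obtained from $F$ by adding $r-2$ new vertices to each edge, all added vertices being distinct. $\bigcup_{i=1}^k S^+_{d_i}$ denotes the vertex-disjoint union of $S^+_{d_1},\dots,S^+_{d_k}$. -}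

module Defs where

open import Data.Fin.Base using (Fin; zero; suc; toℕ)
open import Data.Fin.Subset using (Subset; inside; ⊥; ⊤; ⁅_⁆; _∈_; _∩_; ∣_∣)
open import Data.Integer.Base using (+_; _⊖_)
open import Data.List.Base using (List; []; length; map; lookup; tabulate; _++_)
open import Data.List.Relation.Unary.All using (All)
open import Data.List.Relation.Unary.AllPairs using (AllPairs)
open import Data.List.Relation.Unary.Any using (Any)
open import Data.List.Relation.Unary.Unique.Propositional using (Unique)
open import Data.Nat.Base as ℕ using (ℕ; zero; suc; 2+; NonZero; NonTrivial)
open import Data.Nat.Combinatorics using (_C_; nC1≡n; nCk+nC[k+1]≡[n+1]C[k+1])
open import Data.Nat.Properties using (module ≤-Reasoning; m≤m+n)
open import Data.Product.Base using (∃-syntax; _×_)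
open import Data.Rational.Base as ℚ using (ℚ; 0ℚ; _/_; _+_; _*_; _-_; _⊔_)
import Data.Vec.Base as Vec
import Data.Vec.Functional as Vector
open import Function.Base using (_∘_)
open import Function.Bundles using (_⇔_)
open import Function.Definitions using (Injective)
open import Relation.Binary.PropositionalEquality using (_≡_)
open import Relation.Nullary.Negation using (¬_)

-- A hypergraph on the vertex set Fin n, given by its edges. The list stands
-- for a set: distinctness is demanded of the hypergraphs counted by ex^lin
-- (see Simple), while the order of the list never matters.
Hypergraph : ℕ → Set
Hypergraph n = List (Subset n)

Simple : ∀ {n} → Hypergraph n → Set
Simple = Unique

Uniform : ℕ → ∀ {n} → Hypergraph n → Set
Uniform r = All (λ e → ∣ e ∣ ≡ r)

Linear : ∀ {n} → Hypergraph n → Set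
Linear = AllPairs (λ e f → ∣ e ∩ f ∣ ℕ.≤ 1)

IsImage : ∀ {m n} → (Fin m → Fin n) → Subset m → Subset n → Set
IsImage φ e h = ∀ x → x ∈ h ⇔ (∃[ v ] v ∈ e × φ v ≡ x)

-- Not necessarily induced.
infix 4 _⊑_
_⊑_ : ∀ {m n} → Hypergraph m → Hypergraph n → Set
F ⊑ H = ∃[ φ ] Injective _≡_ _≡_ φ × All (λ e → Any (IsImage φ e) H) F

-- K_{1,ℓ}, with centre zero and leaves suc j.
star : ∀ ℓ → Hypergraph (suc ℓ)
star ℓ = tabulate (λ j → inside Vec.∷ ⁅ j ⁆)

-- The new vertices form length F consecutive blocks of r ∸ 2 vertices, and
-- the j-th edge is enlarged by the whole j-th block. Meant for r ≥ 2 and for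
-- graphs F, i.e. all edges of size 2.
expansion : ∀ r {n} (F : Hypergraph n) → Hypergraph (n ℕ.+ length F ℕ.* (r ℕ.∸ 2))
expansion r F = tabulate λ j →
  lookup F j Vec.++ Vec.concat (Vec.replicate (length F) ⊥ Vec.[ j ]≔ ⊤)

disjointUnion : ∀ {k} {n : Fin k → ℕ} → (∀ i → Hypergraph (n i)) →
                Hypergraph (Vector.foldr ℕ._+_ 0 n)
disjointUnion {zero}  F = []
disjointUnion {suc k} F = map (Vec._++ ⊥) (F zero)
                       ++ map (⊥ Vec.++_) (disjointUnion (F ∘ suc))

starForest⁺ : ∀ r {k} (d : Fin k → ℕ) → Hypergraph _
starForest⁺ r d = disjointUnion (λ i → expansion r (star (d i)))

Attains : ℕ → ℕ → ∀ {v} → Hypergraph v → ℕ → Set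
Attains r n F m = ∃[ H ] length H ≡ m × Simple {n} H × Uniform r H × Linear H × ¬ (F ⊑ H)

-- m = ex^lin_r(n, F)
IsExLin : ℕ → ℕ → ∀ {v} → Hypergraph v → ℕ → Set
IsExLin r n F m = Attains r n F m × (∀ m′ → Attains r n F m′ → m′ ℕ.≤ m)

maximum : ∀ {k} .{{_ : NonZero k}} → (Fin k → ℚ) → ℚ
maximum {suc k} f = Vec.foldr₁ _⊔_ (Vec.tabulate f)

r∸1-nonZero : ∀ r .{{_ : NonTrivial r}} → NonZero (r ℕ.∸ 1)
r∸1-nonZero (2+ _) = _

rC2-nonZero : ∀ r .{{_ : NonTrivial r}} → NonZero (r C 2)
rC2-nonZero (2+ s) = ℕ.>-nonZero (begin
  1                       ≤⟨ ℕ.s≤s ℕ.z≤n ⟩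
  suc s                   ≡⟨ nC1≡n (suc s) ⟨
  suc s C 1               ≤⟨ m≤m+n _ _ ⟩
  suc s C 1 ℕ.+ suc s C 2 ≡⟨ nCk+nC[k+1]≡[n+1]C[k+1] (suc s) 1 ⟩
  2+ s C 2                ∎)
  where open ≤-Reasoning

ℕ→ℚ : ℕ → ℚ
ℕ→ℚ m = + m / 1

-- Indices start from zero, so toℕ i is i - 1 in the usual numbering d₁ ≥ … ≥ d_k;
-- _⊖_ is the subtraction of naturals with integer values.
term : ∀ r .{{_ : NonTrivial r}} {k} → (Fin k → ℕ) → ℕ → Fin k → ℚ
term r d n i =
    ((d i ⊖ 1) / r + + toℕ i / (r ℕ.∸ 1)) * ((n ⊖ toℕ i) / 1)
  + + (toℕ i C 2) / (r C 2)
  where instance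
    _ = ℕ.nonTrivial⇒nonZero r
    _ = r∸1-nonZero r
    _ = rC2-nonZero r

bound : ∀ r .{{_ : NonTrivial r}} {k} .{{_ : NonZero k}} → (Fin k → ℕ) → ℕ → ℚ
bound r d n = maximum (term r d n)

-- f = (1 + o(1)) g, stated without division as g may vanish.
infix 4 _∼_
_∼_ : (ℕ → ℚ) → (ℕ → ℚ) → Set
f ∼ g = ∀ ε → 0ℚ ℚ.< ε →
  ∃[ N ] ∀ n → N ℕ.≤ n → ℚ.∣ f n - g n ∣ ℚ.≤ ε * ℚ.∣ g n ∣

{-# OPTIONS --safe #-}

-- Upper bound. Call the vertices of degree at least some constant hubs. If
-- there are k of them, disjoint stars at the hubs are found greedily, since by
-- linearity every forbidden vertex spoils at most one edge at a hub. If there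
-- are b < k hubs, search greedily for disjoint stars with d_{b+1}, d_{b+2}, …
-- edges outside the hubs. If all are found, the hubs complete the forest. If
-- the search fails at d_{j+1}, all degrees outside the hubs and the boundedly
-- many used vertices are less than d_{j+1}, and counting edges gives the term
-- with number j + 1: exactly for j = b, since no vertex is used then, and with
-- linear slack n / (r - 1) for j > b. The edges meeting the hubs are counted
-- by weighted pairs of vertices, a pair inside the hubs having weight 1 and a
-- pair leaving them weight r.
--
-- Lower bound. For the i-th term take i - 1 hubs and a grid. The edges avoiding
-- the hubs are pieces of grid lines with d_i - 1 different slopes, so a star
-- with d_i edges has an edge through a hub, and i stars cannot be disjoint.
module Submission where

open import Defs
open import Data.Bool.Base using (Bool; true; false; if_then_else_; _∧_)
import Data.Bool.Properties as Bool
open import Data.Empty using (⊥-elim)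
open import Data.Fin.Base as Fin using (Fin; zero; suc; toℕ; _↑ˡ_; _↑ʳ_)
import Data.Fin.Properties as Fin
open import Data.Fin.Subset
  using (Subset; inside; outside; ⊥; ⊤; ⁅_⁆; _∈_; _∉_; _⊆_; _∩_; _∪_; _-_; ∁; ∣_∣; Nonempty)
open import Data.Fin.Subset.Properties
open import Data.Integer.Base as ℤ using (+[1+_]; +≤+)
import Data.Integer.Properties as ℤ
open import Data.List.Base as List using (List; []; _∷_; length)
open import Data.List.Membership.Propositional using () renaming (_∈_ to _∈ₗ_)
open import Data.List.Membership.Propositional.Properties
import Data.List.Properties as List
open import Data.List.Relation.Unary.All as All using (All; []; _∷_)
import Data.List.Relation.Unary.All.Properties as All
open import Data.List.Relation.Unary.AllPairs using (AllPairs; []; _∷_; allPairs?)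
import Data.List.Relation.Unary.AllPairs.Properties as AllPairs
open import Data.List.Relation.Unary.Any as Any using (Any)
import Data.List.Relation.Unary.Any.Properties as Any
open import Data.Maybe.Base using (Maybe; just; nothing)
open import Data.Nat.Base as ℕ
  using (ℕ; zero; suc; 2+; _+_; _*_; _∸_; _^_; _≤_; _<_; z≤n; s≤s; NonZero; NonTrivial)
open import Data.Nat.Combinatorics using (_C_; nC1≡n; nCk+nC[k+1]≡[n+1]C[k+1])
import Data.Nat.DivMod as ℕ
import Data.Nat.Properties as ℕ
open import Data.Nat.Tactic.RingSolver using (solve-∀)
open import Data.Product.Base using (Σ-syntax; ∃-syntax; _×_; _,_; proj₁; proj₂; uncurry)
open import Data.Rational.Base as ℚ using (ℚ; 0ℚ; 1ℚ; mkℚ; _/_; toℚᵘ; *<*)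
import Data.Rational.Properties as ℚ
open import Data.Rational.Solver using (module +-*-Solver)
open import Data.Rational.Unnormalised.Base as ℚᵘ using (mkℚᵘ; *≡*; *≤*; _≃_)
import Data.Rational.Unnormalised.Properties as ℚᵘ
open import Data.Sum.Base as Sum using (_⊎_; inj₁; inj₂; [_,_]′)
open import Data.Sum.Properties using (inj₂-injective)
open import Data.Unit.Base using () renaming (⊤ to Unit)
open import Data.Vec.Base as Vec using (_∷_; []; lookup; here; there)
import Data.Vec.Functional as Vector
import Data.Vec.Properties as Vec
open import Function.Base using (_∘_; case_of_)
open import Function.Bundles using (mk⇔; Equivalence)
open import Function.Definitions using (Injective)
open import Relation.Binary.PropositionalEquality
open import Relation.Nullary using (¬_; Dec; yes; no; does; contradiction)
open import Relation.Nullary.Decidable using (_×-dec_; _→-dec_; ¬?; map′; dec-true)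
open import Relation.Unary using (Decidable)

open import Algebra.Properties.Semiring.Sum ℕ.+-*-semiring
  using (sum; sum-cong-≗; sum-syntax; ∑-distrib-+; ∑-comm; *-distribˡ-sum; *-distribʳ-sum)

-- Counting in linear hypergraphs

-- The case of b hubs with the search failing at once leaves no room for error. Adding up the bounds
-- (n - 1) / (r - 1) for the degrees of the hubs would exceed the term by the constant b (b - 1) /
-- r, because pairs of hubs are counted twice and edges with several hubs repeatedly. Hence the
-- weighted count of pairs, which is exact both for edges with one hub and for edges inside the
-- hubs. The grid lives in the natural numbers and not modulo a prime. Its lines never wrap around,
-- so no divisibility condition on n arises, and the price is a bounded number of rows. Each hub
-- serves a single slope: pieces of equal slope are disjoint in the grid and may share a hub,
-- whereas pieces of different slopes may already share a grid point. The construction falls short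
-- of the bound by an additive constant only, which is negligible once some term grows linearly. All
-- counting is done in ℕ after multiplication by r (r - 1); rationals enter only at the end.

χ : ∀ {n} → Subset n → Fin n → ℕ
χ S v = if lookup S v then 1 else 0

χ≤1 : ∀ {n} (S : Subset n) v → χ S v ≤ 1
χ≤1 S v with lookup S v
... | true  = s≤s z≤n
... | false = z≤n

χ-∈ : ∀ {n} {S : Subset n} {v} → v ∈ S → χ S v ≡ 1
χ-∈ v∈S rewrite Vec.[]=⇒lookup v∈S = refl

χ-∉ : ∀ {n} {S : Subset n} {v} → v ∉ S → χ S v ≡ 0
χ-∉ {S = S} {v} v∉S with lookup S v in eq
... | true  = contradiction (Vec.lookup⇒[]= v S eq) v∉S
... | false = refl

card≡∑χ : ∀ {n} (S : Subset n) → ∣ S ∣ ≡ ∑[ v < n ] χ S v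
card≡∑χ []            = refl
card≡∑χ (inside  ∷ S) = cong suc (card≡∑χ S)
card≡∑χ (outside ∷ S) = card≡∑χ S

∑-mono : ∀ {n} {f g : Fin n → ℕ} → (∀ i → f i ≤ g i) → sum f ≤ sum g
∑-mono {zero}  f≤g = z≤n
∑-mono {suc n} f≤g = ℕ.+-mono-≤ (f≤g zero) (∑-mono (f≤g ∘ suc))

-- Serves the codegree: there each summand tells whether an edge contains a fixed pair of vertices,
-- and linearity leaves one such edge.
∑-≤1 : ∀ {n} {f : Fin n → ℕ} → (∀ i → f i ≤ 1) → (∀ i j → 1 ≤ f i → 1 ≤ f j → i ≡ j) → sum f ≤ 1
∑-≤1 {zero}      f≤1 unique = z≤n
∑-≤1 {suc n} {f} f≤1 unique with 1 ℕ.≤? f zero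
... | no f₀<1 rewrite ℕ.n<1⇒n≡0 (ℕ.≰⇒> f₀<1) =
  ∑-≤1 (f≤1 ∘ suc) (λ i j p q → Fin.suc-injective (unique _ _ p q))
... | yes f₀≥1 = begin
  f zero + sum (f ∘ suc)         ≤⟨ ℕ.+-mono-≤ (f≤1 zero) (∑-mono rest≤0) ⟩
  1 + ∑[ i < n ] 0               ≡⟨ cong suc (∑0≡0 n) ⟩
  1                              ∎
  where
  open ℕ.≤-Reasoning
  rest≤0 : ∀ i → f (suc i) ≤ 0
  rest≤0 i with 1 ℕ.≤? f (suc i)
  ... | yes p = case unique zero (suc i) f₀≥1 p of λ ()
  ... | no ¬p = ℕ.≤-pred (ℕ.≰⇒> ¬p)
  ∑0≡0 : ∀ n → ∑[ i < n ] 0 ≡ 0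
  ∑0≡0 zero    = refl
  ∑0≡0 (suc n) = ∑0≡0 n

∑χ*≤ : ∀ {n} (S : Subset n) {f : Fin n → ℕ} {c} → (∀ {v} → v ∈ S → f v ≤ c) →
       ∑[ v < n ] (χ S v * f v) ≤ ∣ S ∣ * c
∑χ*≤ {n} S {f} {c} f≤c = begin
  ∑[ v < n ] (χ S v * f v) ≤⟨ ∑-mono pointwise ⟩
  ∑[ v < n ] (χ S v * c)   ≡⟨ *-distribʳ-sum c (χ S) ⟨
  sum (χ S) * c            ≡⟨ cong (_* c) (card≡∑χ S) ⟨
  ∣ S ∣ * c                ∎
  where
  open ℕ.≤-Reasoning
  pointwise : ∀ v → χ S v * f v ≤ χ S v * c
  pointwise v with v ∈? S
  ... | yes v∈S = ℕ.*-monoʳ-≤ (χ S v) (f≤c v∈S)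
  ... | no  v∉S rewrite χ-∉ v∉S = z≤n

≤∑χ* : ∀ {n} (S : Subset n) {f : Fin n → ℕ} {c} → (∀ {v} → v ∈ S → c ≤ f v) →
       ∣ S ∣ * c ≤ ∑[ v < n ] (χ S v * f v)
≤∑χ* {n} S {f} {c} c≤f = begin
  ∣ S ∣ * c                ≡⟨ cong (_* c) (card≡∑χ S) ⟩
  sum (χ S) * c            ≡⟨ *-distribʳ-sum c (χ S) ⟩
  ∑[ v < n ] (χ S v * c)   ≤⟨ ∑-mono pointwise ⟩
  ∑[ v < n ] (χ S v * f v) ∎
  where
  open ℕ.≤-Reasoning
  pointwise : ∀ v → χ S v * c ≤ χ S v * f v
  pointwise v with v ∈? S
  ... | yes v∈S = ℕ.*-monoʳ-≤ (χ S v) (c≤f v∈S)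
  ... | no  v∉S rewrite χ-∉ v∉S = z≤n

χ-∩ : ∀ {n} (S T : Subset n) v → χ (S ∩ T) v ≡ χ S v * χ T v
χ-∩ S T v rewrite Vec.lookup-zipWith _∧_ v S T with lookup S v | lookup T v
... | true  | true  = refl
... | true  | false = refl
... | false | _     = refl

∣∩∣≡∑ : ∀ {n} (S T : Subset n) → ∣ S ∩ T ∣ ≡ ∑[ v < n ] (χ S v * χ T v)
∣∩∣≡∑ S T = trans (card≡∑χ (S ∩ T)) (sum-cong-≗ (χ-∩ S T))

∣∩∣+∣∩∁∣ : ∀ {n} (S T : Subset n) → ∣ S ∩ T ∣ + ∣ S ∩ ∁ T ∣ ≡ ∣ S ∣
∣∩∣+∣∩∁∣ []            []            = refl
∣∩∣+∣∩∁∣ (outside ∷ S) (_ ∷ T)       = ∣∩∣+∣∩∁∣ S T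
∣∩∣+∣∩∁∣ (inside  ∷ S) (inside  ∷ T) = cong suc (∣∩∣+∣∩∁∣ S T)
∣∩∣+∣∩∁∣ (inside  ∷ S) (outside ∷ T) = trans (ℕ.+-suc _ _) (cong suc (∣∩∣+∣∩∁∣ S T))

∣∪∣≤ : ∀ {n} (S T : Subset n) → ∣ S ∪ T ∣ ≤ ∣ S ∣ + ∣ T ∣
∣∪∣≤ []            []            = z≤n
∣∪∣≤ (outside ∷ S) (outside ∷ T) = ∣∪∣≤ S T
∣∪∣≤ (outside ∷ S) (inside  ∷ T) = ℕ.≤-trans (s≤s (∣∪∣≤ S T)) (ℕ.≤-reflexive (sym (ℕ.+-suc _ _)))
∣∪∣≤ (inside  ∷ S) (outside ∷ T) = s≤s (∣∪∣≤ S T)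
∣∪∣≤ (inside  ∷ S) (inside  ∷ T) = s≤s (ℕ.≤-trans (∣∪∣≤ S T) (ℕ.+-monoʳ-≤ ∣ S ∣ (ℕ.n≤1+n _)))

∣p∣≡1+∣p-x∣ : ∀ {n} {S : Subset n} {v} → v ∈ S → ∣ S ∣ ≡ suc ∣ S - v ∣
∣p∣≡1+∣p-x∣ {S = inside  ∷ S} here        = cong (suc ∘ ∣_∣) (sym (p─⊥≡p S))
∣p∣≡1+∣p-x∣ {S = inside  ∷ S} (there v∈S) = cong suc (∣p∣≡1+∣p-x∣ v∈S)
∣p∣≡1+∣p-x∣ {S = outside ∷ S} (there v∈S) = ∣p∣≡1+∣p-x∣ v∈S

x∈p-y⇒x∈p×x≢y : ∀ {n} (S : Subset n) {x y} → x ∈ S - y → x ∈ S × x ≢ y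
x∈p-y⇒x∈p×x≢y S {x} {y} x∈ = p─q⊆p S ⁅ y ⁆ x∈ , λ { refl → go S x∈ }
  where
  go : ∀ {n} (S : Subset n) {y} → y ∉ S - y
  go (inside  ∷ S) {suc y} (there p) = go S p
  go (outside ∷ S) {suc y} (there p) = go S p

abstract
  -- Kept abstract, so that a set given by a decidable predicate is used through membership and
  -- never unfolds to its Boolean vector.
  ⟪_⟫ : ∀ {n p} {P : Fin n → Set p} → Decidable P → Subset n
  ⟪ P? ⟫ = Vec.tabulate (does ∘ P?)

  lookup-⟪⟫ : ∀ {n p} {P : Fin n → Set p} (P? : Decidable P) v → lookup ⟪ P? ⟫ v ≡ does (P? v)
  lookup-⟪⟫ P? = Vec.lookup∘tabulate (does ∘ P?)

module _ {n p} {P : Fin n → Set p} (P? : Decidable P) where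
  ∈⟪⟫⁺ : ∀ {v} → P v → v ∈ ⟪ P? ⟫
  ∈⟪⟫⁺ {v} Pv = Vec.lookup⇒[]= v _ (trans (lookup-⟪⟫ P? v) (dec-true (P? v) Pv))

  ∈⟪⟫⁻ : ∀ {v} → v ∈ ⟪ P? ⟫ → P v
  ∈⟪⟫⁻ {v} v∈ = witness (P? v) (trans (sym (lookup-⟪⟫ P? v)) (Vec.[]=⇒lookup v∈))
    where
    witness : (P? : Dec (P v)) → does P? ≡ true → P v
    witness (yes Pv) _ = Pv

enum : ∀ {n} (S : Subset n) → Fin ∣ S ∣ → Fin n
enum (inside  ∷ S) zero    = zero
enum (inside  ∷ S) (suc a) = suc (enum S a)
enum (outside ∷ S) a       = suc (enum S a)

enum-∈ : ∀ {n} (S : Subset n) a → enum S a ∈ S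
enum-∈ (inside  ∷ S) zero    = here
enum-∈ (inside  ∷ S) (suc a) = there (enum-∈ S a)
enum-∈ (outside ∷ S) a       = there (enum-∈ S a)

enum-injective : ∀ {n} (S : Subset n) → Injective _≡_ _≡_ (enum S)
enum-injective (inside  ∷ S) {zero}  {zero}  eq = refl
enum-injective (inside  ∷ S) {suc a} {suc b} eq = cong suc (enum-injective S (Fin.suc-injective eq))
enum-injective (outside ∷ S) eq = enum-injective S (Fin.suc-injective eq)

enum-surjective : ∀ {n} {S : Subset n} {v} → v ∈ S → ∃[ a ] enum S a ≡ v
enum-surjective {S = inside  ∷ S} here        = zero , refl
enum-surjective {S = inside  ∷ S} (there v∈S) =
  let a , eq = enum-surjective v∈S in suc a , cong suc eq
enum-surjective {S = outside ∷ S} (there v∈S) =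
  let a , eq = enum-surjective v∈S in a , cong suc eq

choose : ∀ {n d} (S : Subset n) → d ≤ ∣ S ∣ →
         Σ[ e ∈ (Fin d → Fin n) ] Injective _≡_ _≡_ e × (∀ a → e a ∈ S)
choose S d≤ = enum S ∘ (λ a → Fin.inject≤ a d≤) ,
  Fin.inject≤-injective d≤ d≤ _ _ ∘ enum-injective S , enum-∈ S ∘ _

injective⇒≤∣∣ : ∀ {n d} (S : Subset n) {f : Fin d → Fin n} → Injective _≡_ _≡_ f → (∀ a → f a ∈ S) → d ≤ ∣ S ∣
injective⇒≤∣∣ S {f} inj f∈ = Fin.injective⇒≤ {f = proj₁ ∘ index} λ {a} {b} eq →
  inj (trans (sym (proj₂ (index a))) (trans (cong (enum S) eq) (proj₂ (index b))))
  where
  index : ∀ a → ∃[ i ] enum S i ≡ f a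
  index a = enum-surjective (f∈ a)

covered⇒∣∣≤ : ∀ {n d} (S : Subset n) (f : Fin d → Fin n) → (∀ {v} → v ∈ S → ∃[ a ] f a ≡ v) → ∣ S ∣ ≤ d
covered⇒∣∣≤ S f cover = Fin.injective⇒≤ {f = proj₁ ∘ index} λ {a} {b} eq →
  enum-injective S (trans (sym (proj₂ (index a))) (trans (cong f eq) (proj₂ (index b))))
  where
  index : ∀ a → ∃[ i ] f i ≡ enum S a
  index a = cover (enum-∈ S a)

module _ {n d} (f : Fin d → Fin n) where
  private
    hit? : Decidable (λ v → ∃[ a ] f a ≡ v)
    hit? v = Fin.any? (λ a → f a Fin.≟ v)

  image : Subset n
  image = ⟪ hit? ⟫

  ∈-image⁺ : ∀ a → f a ∈ image
  ∈-image⁺ a = ∈⟪⟫⁺ hit? (a , refl)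

  ∈-image⁻ : ∀ {v} → v ∈ image → ∃[ a ] f a ≡ v
  ∈-image⁻ = ∈⟪⟫⁻ hit?

  ∣image∣≤ : ∣ image ∣ ≤ d
  ∣image∣≤ = covered⇒∣∣≤ image f ∈-image⁻

  ∣image∣≡ : Injective _≡_ _≡_ f → ∣ image ∣ ≡ d
  ∣image∣≡ inj = ℕ.≤-antisym ∣image∣≤ (injective⇒≤∣∣ image inj ∈-image⁺)

⋃ᶠ : ∀ {n d} → (Fin d → Subset n) → Subset n
⋃ᶠ {d = zero}  f = ⊥
⋃ᶠ {d = suc d} f = f zero ∪ ⋃ᶠ (f ∘ suc)

∈⋃ᶠ : ∀ {n d} (f : Fin d → Subset n) a {v} → v ∈ f a → v ∈ ⋃ᶠ f
∈⋃ᶠ f zero    v∈ = x∈p∪q⁺ (inj₁ v∈)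
∈⋃ᶠ f (suc a) v∈ = x∈p∪q⁺ (inj₂ (∈⋃ᶠ (f ∘ suc) a v∈))

∈⋃ᶠ⁻ : ∀ {n d} (f : Fin d → Subset n) {v} → v ∈ ⋃ᶠ f → ∃[ a ] v ∈ f a
∈⋃ᶠ⁻ {d = zero}  f v∈ = contradiction v∈ ∉⊥
∈⋃ᶠ⁻ {d = suc d} f v∈ with x∈p∪q⁻ _ _ v∈
... | inj₁ p = zero , p
... | inj₂ p = let a , q = ∈⋃ᶠ⁻ (f ∘ suc) p in suc a , q

∣⋃ᶠ∣≤ : ∀ {n d c} (f : Fin d → Subset n) → (∀ a → ∣ f a ∣ ≤ c) → ∣ ⋃ᶠ f ∣ ≤ d * c
∣⋃ᶠ∣≤ {n} {zero}  f f≤ = ℕ.≤-reflexive (∣⊥∣≡0 n)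
∣⋃ᶠ∣≤ {n} {suc d} f f≤ = ℕ.≤-trans (∣∪∣≤ (f zero) _) (ℕ.+-mono-≤ (f≤ zero) (∣⋃ᶠ∣≤ (f ∘ suc) (f≤ ∘ suc)))

-- Indexed families of edges and double counting

IsUniform : ℕ → ∀ {m n} → (Fin m → Subset n) → Set
IsUniform r E = ∀ j → ∣ E j ∣ ≡ r

-- Speaks of indices and not of edges: if edges have at least two vertices, it also excludes
-- repetitions, so one property yields both `Linear` and `Simple`.
IsLinear : ∀ {m n} → (Fin m → Subset n) → Set
IsLinear E = ∀ {i j u v} → u ≢ v → u ∈ E i → v ∈ E i → u ∈ E j → v ∈ E j → i ≡ j

Disjoint : ∀ {n} → Subset n → Subset n → Set
Disjoint S T = ∀ {v} → v ∈ S → v ∉ T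

disjoint? : ∀ {n} (S T : Subset n) → Dec (Disjoint S T)
disjoint? S T with nonempty? (S ∩ T)
... | yes (v , v∈) = no λ dis → let p , q = x∈p∩q⁻ S T v∈ in dis p q
... | no empty     = yes λ p q → empty (_ , x∈p∩q⁺ (p , q))

¬disjoint⇒common : ∀ {n} (S T : Subset n) → ¬ Disjoint S T → Nonempty (S ∩ T)
¬disjoint⇒common S T ¬dis with nonempty? (S ∩ T)
... | yes ne   = ne
... | no empty = ⊥-elim (¬dis λ p q → empty (_ , x∈p∩q⁺ (p , q)))

module Counting {m n} (E : Fin m → Subset n) where

  through : Fin n → Subset m
  through v = ⟪ (λ j → v ∈? E j) ⟫

  avoiding : Subset n → Subset m
  avoiding W = ⟪ (λ j → disjoint? (E j) W) ⟫

  meeting : Subset n → Subset m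
  meeting W = ⟪ (λ j → ¬? (disjoint? (E j) W)) ⟫

  ∈through⁺ : ∀ {v j} → v ∈ E j → j ∈ through v
  ∈through⁺ {v} = ∈⟪⟫⁺ (λ j → v ∈? E j)

  ∈through⁻ : ∀ {v j} → j ∈ through v → v ∈ E j
  ∈through⁻ {v} = ∈⟪⟫⁻ (λ j → v ∈? E j)

  ∈avoiding⁺ : ∀ {W j} → Disjoint (E j) W → j ∈ avoiding W
  ∈avoiding⁺ {W} = ∈⟪⟫⁺ (λ j → disjoint? (E j) W)

  ∈avoiding⁻ : ∀ {W j} → j ∈ avoiding W → Disjoint (E j) W
  ∈avoiding⁻ {W} = ∈⟪⟫⁻ (λ j → disjoint? (E j) W)

  ∈meeting⁻ : ∀ {W j} → j ∈ meeting W → ∃[ v ] v ∈ E j × v ∈ W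
  ∈meeting⁻ {W} {j} j∈ =
    let v , v∈ = ¬disjoint⇒common (E j) W (∈⟪⟫⁻ (λ j → ¬? (disjoint? (E j) W)) j∈)
    in v , x∈p∩q⁻ (E j) W v∈

  χ-through : ∀ v j → χ (E j) v ≡ χ (through v) j
  χ-through v j with v ∈? E j
  ... | yes v∈ = trans (χ-∈ v∈) (sym (χ-∈ (∈through⁺ v∈)))
  ... | no  v∉ = trans (χ-∉ v∉) (sym (χ-∉ (v∉ ∘ ∈through⁻)))

  deg : Subset n → Fin n → ℕ
  deg W v = ∣ through v ∩ avoiding W ∣

  m≤avoiding+meeting : ∀ W → m ≤ ∣ avoiding W ∣ + ∣ meeting W ∣
  m≤avoiding+meeting W = begin
    m                                     ≡⟨ ∣⊤∣≡n m ⟨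
    ∣ ⊤ {m} ∣                             ≤⟨ p⊆q⇒∣p∣≤∣q∣ cover ⟩
    ∣ avoiding W ∪ meeting W ∣            ≤⟨ ∣∪∣≤ (avoiding W) (meeting W) ⟩
    ∣ avoiding W ∣ + ∣ meeting W ∣        ∎
    where
    open ℕ.≤-Reasoning
    cover : ⊤ ⊆ avoiding W ∪ meeting W
    cover {j} _ with disjoint? (E j) W
    ... | yes p = x∈p∪q⁺ (inj₁ (∈avoiding⁺ p))
    ... | no ¬p = x∈p∪q⁺ (inj₂ (∈⟪⟫⁺ (λ j → ¬? (disjoint? (E j) W)) ¬p))

  meeting-∪ : ∀ V W → ∣ meeting (V ∪ W) ∣ ≤ ∣ meeting V ∣ + ∣ meeting W ∣
  meeting-∪ V W = ℕ.≤-trans (p⊆q⇒∣p∣≤∣q∣ sub) (∣∪∣≤ (meeting V) (meeting W))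
    where
    sub : meeting (V ∪ W) ⊆ meeting V ∪ meeting W
    sub j∈ with v , v∈E , v∈ ← ∈meeting⁻ {V ∪ W} j∈ with x∈p∪q⁻ V W v∈
    ... | inj₁ p = x∈p∪q⁺ (inj₁ (∈⟪⟫⁺ (λ j → ¬? (disjoint? (E j) V)) (λ dis → dis v∈E p)))
    ... | inj₂ p = x∈p∪q⁺ (inj₂ (∈⟪⟫⁺ (λ j → ¬? (disjoint? (E j) W)) (λ dis → dis v∈E p)))

  -- Incidences are counted from both sides, and the vertices of `B` lie on no edge avoiding `W`.
  -- The two sets differ because the term contains n minus the number of hubs, while `W` also
  -- contains the used vertices.
  avoiding-bound : ∀ {r c} → IsUniform r E → ∀ B W → B ⊆ W →
    (∀ v → deg W v ≤ c) → ∣ avoiding W ∣ * r ≤ (n ∸ ∣ B ∣) * c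
  avoiding-bound {r} {c} unif B W B⊆W deg≤ = begin
    ∣ avoiding W ∣ * r
      ≤⟨ ≤∑χ* (avoiding W) (λ {j} _ → ℕ.≤-reflexive (sym (trans (sym (card≡∑χ (E j))) (unif j)))) ⟩
    ∑[ j < m ] (χ (avoiding W) j * ∑[ v < n ] χ (E j) v)
      ≡⟨ sum-cong-≗ (λ j → *-distribˡ-sum (χ (avoiding W) j) (χ (E j))) ⟩
    ∑[ j < m ] ∑[ v < n ] (χ (avoiding W) j * χ (E j) v)
      ≡⟨ ∑-comm (λ j v → χ (avoiding W) j * χ (E j) v) ⟩
    ∑[ v < n ] ∑[ j < m ] (χ (avoiding W) j * χ (E j) v)
      ≡⟨ sum-cong-≗ (λ v → sum-cong-≗ (λ j →
           trans (ℕ.*-comm (χ (avoiding W) j) _) (cong (_* χ (avoiding W) j) (χ-through v j)))) ⟩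
    ∑[ v < n ] ∑[ j < m ] (χ (through v) j * χ (avoiding W) j)
      ≡⟨ sum-cong-≗ (λ v → ∣∩∣≡∑ (through v) (avoiding W)) ⟨
    ∑[ v < n ] deg W v
      ≤⟨ ∑-mono outside-B ⟩
    ∑[ v < n ] (χ (∁ B) v * deg W v)
      ≤⟨ ∑χ*≤ (∁ B) (λ {v} _ → deg≤ v) ⟩
    ∣ ∁ B ∣ * c
      ≡⟨ cong (_* c) (∣∁p∣≡n∸∣p∣ B) ⟩
    (n ∸ ∣ B ∣) * c ∎
    where
    open ℕ.≤-Reasoning
    outside-B : ∀ v → deg W v ≤ χ (∁ B) v * deg W v
    outside-B v with v ∈? B
    ... | no v∉B rewrite χ-∈ (x∉p⇒x∈∁p v∉B) = ℕ.≤-reflexive (sym (ℕ.+-identityʳ _))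
    ... | yes v∈B = ℕ.≤-trans (ℕ.≤-reflexive deg≡0) z≤n
      where
      deg≡0 : deg W v ≡ 0
      deg≡0 = trans (cong ∣_∣ (Empty-unique λ (j , j∈) →
        let p , q = x∈p∩q⁻ (through v) (avoiding W) j∈
        in ∈avoiding⁻ {W} q (∈through⁻ p) (B⊆W v∈B))) (∣⊥∣≡0 m)

  -- A union bound suffices for the boundedly many used vertices, whose contribution disappears in
  -- the linear slack.
  meeting-bound : ∀ {c} U → (∀ {u} → u ∈ U → ∣ through u ∣ ≤ c) → ∣ meeting U ∣ ≤ ∣ U ∣ * c
  meeting-bound {c} U deg≤ = begin
    ∣ meeting U ∣
      ≡⟨ ℕ.*-identityʳ _ ⟨
    ∣ meeting U ∣ * 1
      ≤⟨ ≤∑χ* (meeting U) some-vertex ⟩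
    ∑[ j < m ] (χ (meeting U) j * ∑[ u < n ] (χ U u * χ (E j) u))
      ≤⟨ ∑-mono (λ j → ℕ.≤-trans (ℕ.*-monoˡ-≤ _ (χ≤1 (meeting U) j)) (ℕ.≤-reflexive (ℕ.+-identityʳ _))) ⟩
    ∑[ j < m ] ∑[ u < n ] (χ U u * χ (E j) u)
      ≡⟨ ∑-comm (λ j u → χ U u * χ (E j) u) ⟩
    ∑[ u < n ] ∑[ j < m ] (χ U u * χ (E j) u)
      ≡⟨ sum-cong-≗ (λ u → trans (sum-cong-≗ (λ j → cong (χ U u *_) (χ-through u j)))
           (trans (sym (*-distribˡ-sum (χ U u) (χ (through u)))) (cong (χ U u *_) (sym (card≡∑χ (through u)))))) ⟩
    ∑[ u < n ] (χ U u * ∣ through u ∣)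
      ≤⟨ ∑χ*≤ U deg≤ ⟩
    ∣ U ∣ * c ∎
    where
    open ℕ.≤-Reasoning
    some-vertex : ∀ {j} → j ∈ meeting U → 1 ≤ ∑[ u < n ] (χ U u * χ (E j) u)
    some-vertex {j} j∈ with u , u∈E , u∈U ← ∈meeting⁻ {U} j∈ = begin
      1                                  ≡⟨ ∣⁅x⁆∣≡1 u ⟨
      ∣ ⁅ u ⁆ ∣                          ≤⟨ p⊆q⇒∣p∣≤∣q∣ (λ x∈ → subst (_∈ U ∩ E j) (sym (x∈⁅y⁆⇒x≡y u x∈)) (x∈p∩q⁺ (u∈U , u∈E))) ⟩
      ∣ U ∩ E j ∣                        ≡⟨ ∣∩∣≡∑ U (E j) ⟩
      ∑[ u < n ] (χ U u * χ (E j) u)     ∎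

  codegree≤1 : IsLinear E → ∀ {u v} → u ≢ v → ∑[ j < m ] (χ (E j) u * χ (E j) v) ≤ 1
  codegree≤1 lin {u} {v} u≢v = ∑-≤1
    (λ j → ℕ.*-mono-≤ (χ≤1 (E j) u) (χ≤1 (E j) v))
    (λ i j p q → let ui , vi = both i p; uj , vj = both j q in lin u≢v ui vi uj vj)
    where
    both : ∀ j → 1 ≤ χ (E j) u * χ (E j) v → u ∈ E j × v ∈ E j
    both j p with u ∈? E j | v ∈? E j
    ... | yes u∈ | yes v∈ = u∈ , v∈
    ... | no  u∉ | _      rewrite χ-∉ u∉ = contradiction p λ ()
    ... | yes _  | no v∉  rewrite χ-∉ v∉ | ℕ.*-zeroʳ (χ (E j) u) = contradiction p λ ()

  -- Ordered pairs (u , v) of vertices in a common edge are counted, with u in `B`; by linearity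
  -- each lies in at most one edge. For b hubs the right side, divided by r (r - 1), is b (n - b) /
  -- (r - 1) + (b C 2) / (r C 2), exactly the part of the term with number b + 1 that does not
  -- depend on d.
  meeting-quadratic : ∀ {r} → 1 ≤ r → IsUniform r E → IsLinear E → ∀ B →
    ∣ meeting B ∣ * (r * (r ∸ 1)) ≤ ∣ B ∣ * (∣ B ∣ ∸ 1 + r * (n ∸ ∣ B ∣))
  meeting-quadratic {r} 1≤r unif lin B = begin
    ∣ meeting B ∣ * (r * (r ∸ 1))
      ≤⟨ ≤∑χ* (meeting B) (λ {j} → edge-weight j) ⟩
    ∑[ j < m ] (χ (meeting B) j * ∑[ u < n ] (χ (B ∩ E j) u * weight j u))
      ≤⟨ ∑-mono (λ j → ℕ.≤-trans (ℕ.*-monoˡ-≤ _ (χ≤1 (meeting B) j)) (ℕ.≤-reflexive (ℕ.+-identityʳ _))) ⟩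
    ∑[ j < m ] ∑[ u < n ] (χ (B ∩ E j) u * weight j u)
      ≡⟨ sum-cong-≗ (λ j → sum-cong-≗ (λ u → rearrange j u)) ⟩
    ∑[ j < m ] ∑[ u < n ] (χ B u * ∑[ v < n ] (w u v * (χ (E j) u * χ (E j) v)))
      ≡⟨ ∑-comm (λ j u → χ B u * ∑[ v < n ] (w u v * (χ (E j) u * χ (E j) v))) ⟩
    ∑[ u < n ] ∑[ j < m ] (χ B u * ∑[ v < n ] (w u v * (χ (E j) u * χ (E j) v)))
      ≡⟨ sum-cong-≗ (λ u → *-distribˡ-sum (χ B u) (λ j → ∑[ v < n ] (w u v * (χ (E j) u * χ (E j) v)))) ⟨
    ∑[ u < n ] (χ B u * ∑[ j < m ] ∑[ v < n ] (w u v * (χ (E j) u * χ (E j) v)))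
      ≤⟨ ∑χ*≤ B vertex-weight ⟩
    ∣ B ∣ * (∣ B ∣ ∸ 1 + r * (n ∸ ∣ B ∣)) ∎
    where
    open ℕ.≤-Reasoning

    -- A pair inside `B` occurs in both orders with weight 1, a pair leaving `B` once with weight
    -- `r`. Removing `u` gives the diagonal weight 0; on the diagonal the codegree would be the
    -- whole degree of `u`.
    w : Fin n → Fin n → ℕ
    w u v = χ (B - u) v + r * χ (∁ B) v

    weight : Fin m → Fin n → ℕ
    weight j u = ∑[ v < n ] (w u v * χ (E j) v)

    rearrange : ∀ j u → χ (B ∩ E j) u * weight j u ≡
                        χ B u * ∑[ v < n ] (w u v * (χ (E j) u * χ (E j) v))
    rearrange j u rewrite χ-∩ B (E j) u = trans (ℕ.*-assoc (χ B u) _ _) (cong (χ B u *_)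
      (trans (*-distribˡ-sum (χ (E j) u) (λ v → w u v * χ (E j) v))
        (sum-cong-≗ (λ v → shuffle (χ (E j) u) (w u v) (χ (E j) v)))))
      where
      shuffle : ∀ a b c → a * (b * c) ≡ b * (a * c)
      shuffle = solve-∀

    ∑w : ∀ u (S : Subset n) → ∑[ v < n ] (w u v * χ S v) ≡ ∣ (B - u) ∩ S ∣ + r * ∣ ∁ B ∩ S ∣
    ∑w u S = begin-equality
      ∑[ v < n ] (w u v * χ S v)
        ≡⟨ sum-cong-≗ (λ v → expand (χ (B - u) v) r (χ (∁ B) v) (χ S v)) ⟩
      ∑[ v < n ] (χ (B - u) v * χ S v + r * (χ (∁ B) v * χ S v))
        ≡⟨ ∑-distrib-+ (λ v → χ (B - u) v * χ S v) (λ v → r * (χ (∁ B) v * χ S v)) ⟩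
      ∑[ v < n ] (χ (B - u) v * χ S v) + ∑[ v < n ] (r * (χ (∁ B) v * χ S v))
        ≡⟨ cong₂ _+_ (∣∩∣≡∑ (B - u) S) (trans (cong (r *_) (∣∩∣≡∑ (∁ B) S)) (*-distribˡ-sum r (λ v → χ (∁ B) v * χ S v))) ⟨
      ∣ (B - u) ∩ S ∣ + r * ∣ ∁ B ∩ S ∣ ∎
      where
      expand : ∀ a r b c → (a + r * b) * c ≡ a * c + r * (b * c)
      expand = solve-∀

    w-self : ∀ {u} → u ∈ B → w u u ≡ 0
    w-self {u} u∈B rewrite χ-∉ {S = B - u} {u} (λ p → proj₂ (x∈p-y⇒x∈p×x≢y B p) refl)
                         | χ-∉ (x∈p⇒x∉∁p u∈B) = ℕ.*-zeroʳ r

    vertex-weight : ∀ {u} → u ∈ B →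
      ∑[ j < m ] ∑[ v < n ] (w u v * (χ (E j) u * χ (E j) v)) ≤ ∣ B ∣ ∸ 1 + r * (n ∸ ∣ B ∣)
    vertex-weight {u} u∈B = begin
      ∑[ j < m ] ∑[ v < n ] (w u v * (χ (E j) u * χ (E j) v))
        ≡⟨ ∑-comm (λ j v → w u v * (χ (E j) u * χ (E j) v)) ⟩
      ∑[ v < n ] ∑[ j < m ] (w u v * (χ (E j) u * χ (E j) v))
        ≡⟨ sum-cong-≗ (λ v → *-distribˡ-sum (w u v) (λ j → χ (E j) u * χ (E j) v)) ⟨
      ∑[ v < n ] (w u v * ∑[ j < m ] (χ (E j) u * χ (E j) v))
        ≤⟨ ∑-mono pair-weight ⟩
      ∑[ v < n ] (w u v * χ ⊤ v)
        ≡⟨ ∑w u ⊤ ⟩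
      ∣ (B - u) ∩ ⊤ ∣ + r * ∣ ∁ B ∩ ⊤ ∣
        ≡⟨ cong₂ (λ S T → ∣ S ∣ + r * ∣ T ∣) (∩-identityʳ (B - u)) (∩-identityʳ (∁ B)) ⟩
      ∣ B - u ∣ + r * ∣ ∁ B ∣
        ≡⟨ cong₂ (λ x y → x + r * y) (cong (_∸ 1) (sym (∣p∣≡1+∣p-x∣ u∈B))) (∣∁p∣≡n∸∣p∣ B) ⟩
      ∣ B ∣ ∸ 1 + r * (n ∸ ∣ B ∣) ∎
      where
      pair-weight : ∀ v → w u v * ∑[ j < m ] (χ (E j) u * χ (E j) v) ≤ w u v * χ ⊤ v
      pair-weight v with u Fin.≟ v
      ... | yes refl rewrite w-self u∈B = z≤n
      ... | no  u≢v rewrite χ-∈ (∈⊤ {x = v}) = ℕ.*-monoʳ-≤ (w u v) (codegree≤1 lin u≢v)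

    -- For t = 1 + a the number of vertices of an edge in B and c the number
    -- outside, the edge has t (a + r c) ≥ r (r - 1), a concave function of t
    -- with equality at t = 1 and t = r.
    concavity : ∀ a c → (suc a + c) * (a + c) ≤ suc a * (a + (suc a + c) * c)
    concavity a c = subst ((suc a + c) * (a + c) ≤_) (sym (identity a c)) (ℕ.m≤m+n _ _)
      where
      identity : ∀ a c → (1 + a) * (a + (1 + a + c) * c) ≡ (1 + a + c) * (a + c) + (a * a * c + a * c * c)
      identity = solve-∀

    edge-weight : ∀ j → j ∈ meeting B → r * (r ∸ 1) ≤ ∑[ u < n ] (χ (B ∩ E j) u * weight j u)
    edge-weight j j∈ = begin
      r * (r ∸ 1)
        ≡⟨ cong (λ x → x * (x ∸ 1)) r≡ ⟩
      (suc a + c) * (a + c)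
        ≤⟨ concavity a c ⟩
      suc a * (a + (suc a + c) * c)
        ≡⟨ cong₂ (λ t s → t * (a + s * c)) (sym t≡) (sym r≡) ⟩
      ∣ B ∩ E j ∣ * (a + r * c)
        ≤⟨ ≤∑χ* (B ∩ E j) (λ p → ℕ.≤-reflexive (sym (weight≡ p))) ⟩
      ∑[ u < n ] (χ (B ∩ E j) u * weight j u) ∎
      where
      a = ∣ B ∩ E j ∣ ∸ 1
      c = ∣ ∁ B ∩ E j ∣
      t≡ : ∣ B ∩ E j ∣ ≡ suc a
      t≡ = let v , p , q = ∈meeting⁻ {B} j∈
               eq = ∣p∣≡1+∣p-x∣ (x∈p∩q⁺ (q , p))
           in trans eq (cong suc (sym (cong (_∸ 1) eq)))
      r≡ : r ≡ suc a + c
      r≡ = trans (sym (unif j)) (trans (sym (∣∩∣+∣∩∁∣ (E j) B))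
             (cong₂ _+_ (trans (cong ∣_∣ (∩-comm (E j) B)) t≡) (cong ∣_∣ (∩-comm (E j) (∁ B)))))
      weight≡ : ∀ {u} → u ∈ B ∩ E j → weight j u ≡ a + r * c
      weight≡ {u} u∈ = trans (∑w u (E j)) (cong (_+ r * c) (begin-equality
        ∣ (B - u) ∩ E j ∣     ≡⟨ cong ∣_∣ (⊆-antisym sub₁ sub₂) ⟩
        ∣ (B ∩ E j) - u ∣     ≡⟨ cong (_∸ 1) (∣p∣≡1+∣p-x∣ u∈) ⟨
        ∣ B ∩ E j ∣ ∸ 1       ∎))
        where
        sub₁ : (B - u) ∩ E j ⊆ (B ∩ E j) - u
        sub₁ x∈ = let p , q = x∈p∩q⁻ _ _ x∈; p₁ , p₂ = x∈p-y⇒x∈p×x≢y B p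
                  in x∈p∧x≢y⇒x∈p-y (x∈p∩q⁺ (p₁ , q)) p₂
        sub₂ : (B ∩ E j) - u ⊆ (B - u) ∩ E j
        sub₂ x∈ = let p , p₂ = x∈p-y⇒x∈p×x≢y (B ∩ E j) x∈; p₁ , q = x∈p∩q⁻ _ _ p
                  in x∈p∩q⁺ (x∈p∧x≢y⇒x∈p-y p₁ p₂ , q)

-- Star forests and their embeddings

open Equivalence using (to; from)

enumerate : ∀ {n d} (S : Subset n) → ∣ S ∣ ≡ d →
  Σ[ e ∈ (Fin d → Fin n) ] Injective _≡_ _≡_ e × (∀ a → e a ∈ S) × (∀ {v} → v ∈ S → ∃[ a ] e a ≡ v)
enumerate S refl = enum S , enum-injective S , enum-∈ S , enum-surjective

module _ {m n} {S : Subset m} {T : Subset n} where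
  ∈-++⁺ˢˡ : ∀ {x} → x ∈ S → x ↑ˡ n ∈ S Vec.++ T
  ∈-++⁺ˢˡ {x} x∈ = Vec.lookup⇒[]= _ _ (trans (Vec.lookup-++ˡ S T x) (Vec.[]=⇒lookup x∈))

  ∈-++⁺ˢʳ : ∀ {y} → y ∈ T → m ↑ʳ y ∈ S Vec.++ T
  ∈-++⁺ˢʳ {y} y∈ = Vec.lookup⇒[]= _ _ (trans (Vec.lookup-++ʳ S T y) (Vec.[]=⇒lookup y∈))

  ∈-++⁻ˢˡ : ∀ {x} → x ↑ˡ n ∈ S Vec.++ T → x ∈ S
  ∈-++⁻ˢˡ {x} x∈ = Vec.lookup⇒[]= _ _ (trans (sym (Vec.lookup-++ˡ S T x)) (Vec.[]=⇒lookup x∈))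

  ∈-++⁻ˢʳ : ∀ {y} → m ↑ʳ y ∈ S Vec.++ T → y ∈ T
  ∈-++⁻ˢʳ {y} y∈ = Vec.lookup⇒[]= _ _ (trans (sym (Vec.lookup-++ʳ S T y)) (Vec.[]=⇒lookup y∈))

data SplitView m {n} : Fin (m + n) → Set where
  left  : ∀ x → SplitView m (x ↑ˡ n)
  right : ∀ y → SplitView m (m ↑ʳ y)

splitView : ∀ m {n} (v : Fin (m + n)) → SplitView m v
splitView m v with Fin.splitAt m v in eq
... | inj₁ x = subst (SplitView m) (Fin.splitAt⁻¹-↑ˡ eq) (left x)
... | inj₂ y = subst (SplitView m) (Fin.splitAt⁻¹-↑ʳ eq) (right y)

-- The shadow of an expanded star. That the edges share only the centre is not recorded, since it
-- follows in a linear host.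
record Star {n} (H : Hypergraph n) (d : ℕ) : Set where
  field
    center     : Fin n
    edge       : Fin d → Subset n
    edge∈H     : ∀ a → edge a ∈ₗ H
    center∈    : ∀ a → center ∈ edge a
    injective  : Injective _≡_ _≡_ edge

-- Disjointness is required of edges only; centres are covered as soon as every star has an edge.
record Forest {n} (H : Hypergraph n) {k} (d : Fin k → ℕ) : Set where
  field
    star-at    : ∀ i → Star H (d i)
  open module S i = Star (star-at i) public
  field
    disjoint   : ∀ {i j} → i ≢ j → ∀ a b → Disjoint (edge i a) (edge j b)

open Forest
open Star using (edge∈H; center∈; injective)

-- `expansion` numbers its blocks by `Fin (length F)`, and `length (star d)` equals `d` only
-- propositionally. An arbitrary `F` with a bijection between edges and leaves keeps the casts out
-- of the arguments below.
module Expanded {d : ℕ} (s : ℕ) (F : Hypergraph (suc d))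
  (leaf : Fin (length F) → Fin d) (spoke : Fin d → Fin (length F))
  (leaf∘spoke : ∀ a → leaf (spoke a) ≡ a) (spoke∘leaf : ∀ j → spoke (leaf j) ≡ j)
  (F≡ : ∀ j → List.lookup F j ≡ inside ∷ ⁅ leaf j ⁆) where

  Vertex : Set
  Vertex = Fin (suc d + length F * s)

  -- A vertex other than the centre is a pair of an edge and a position in it,
  -- position zero being that of the leaf.
  Label : Set
  Label = Maybe (Fin d × Fin (suc s))

  label : Vertex → Label
  label v with Fin.splitAt (suc d) v
  ... | inj₁ zero    = nothing
  ... | inj₁ (suc l) = just (l , zero)
  ... | inj₂ w       = let j , t = Fin.remQuot {length F} s w in just (leaf j , suc t)

  unlabel : Label → Vertex
  unlabel nothing            = zero
  unlabel (just (a , zero))  = suc a ↑ˡ (length F * s)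
  unlabel (just (a , suc t)) = suc d ↑ʳ Fin.combine (spoke a) t

  unlabel-label : ∀ v → unlabel (label v) ≡ v
  unlabel-label v with Fin.splitAt (suc d) v in eq
  ... | inj₁ zero    = Fin.splitAt⁻¹-↑ˡ eq
  ... | inj₁ (suc l) = Fin.splitAt⁻¹-↑ˡ eq
  ... | inj₂ w       = trans (cong (suc d ↑ʳ_) (trans
                         (cong (λ j → Fin.combine j _) (spoke∘leaf _)) (Fin.combine-remQuot {length F} s w)))
                         (Fin.splitAt⁻¹-↑ʳ eq)

  label-unlabel : ∀ x → label (unlabel x) ≡ x
  label-unlabel nothing = refl
  label-unlabel (just (a , zero))
    rewrite Fin.splitAt-↑ˡ d a (length F * s) = refl
  label-unlabel (just (a , suc t))
    rewrite Fin.splitAt-↑ʳ d (length F * s) (Fin.combine (spoke a) t) =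
    trans (cong (λ (j , u) → just (leaf j , suc u)) (Fin.remQuot-combine (spoke a) t))
          (cong (λ b → just (b , suc t)) (leaf∘spoke a))

  blocks : Fin (length F) → Subset (length F * s)
  blocks j = Vec.concat (Vec.replicate (length F) ⊥ Vec.[ j ]≔ ⊤)

  edgeOf : Fin (length F) → Subset (suc d + length F * s)
  edgeOf j = List.lookup F j Vec.++ blocks j

  OnEdge : Fin d → Label → Set
  OnEdge a nothing        = Unit
  OnEdge a (just (b , _)) = b ≡ a

  combine∈blocks⁺ : ∀ j t → Fin.combine j t ∈ blocks j
  combine∈blocks⁺ j t = Vec.lookup⇒[]= _ _ (trans (Vec.lookup-concat (Vec.replicate _ ⊥ Vec.[ j ]≔ ⊤) j t)
    (trans (cong (λ S → lookup S t) (Vec.lookup∘update j (Vec.replicate _ ⊥) ⊤)) (Vec.lookup-replicate t inside)))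

  combine∈blocks⁻ : ∀ {i j t} → Fin.combine i t ∈ blocks j → i ≡ j
  combine∈blocks⁻ {i} {j} {t} p with i Fin.≟ j
  ... | yes i≡j = i≡j
  ... | no  i≢j = contradiction (begin
    inside                                                          ≡⟨ Vec.[]=⇒lookup p ⟨
    lookup (blocks j) (Fin.combine i t)                             ≡⟨ Vec.lookup-concat (Vec.replicate _ ⊥ Vec.[ j ]≔ ⊤) i t ⟩
    lookup (lookup (Vec.replicate _ ⊥ Vec.[ j ]≔ ⊤) i) t            ≡⟨ cong (λ S → lookup S t) (Vec.lookup∘update′ i≢j (Vec.replicate _ ⊥) ⊤) ⟩
    lookup (lookup (Vec.replicate _ ⊥) i) t                         ≡⟨ cong (λ S → lookup S t) (Vec.lookup-replicate i ⊥) ⟩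
    lookup ⊥ t                                                      ≡⟨ Vec.lookup-replicate t outside ⟩
    outside ∎) λ ()
    where open ≡-Reasoning

  unlabel∈ : ∀ j x → OnEdge (leaf j) x → unlabel x ∈ edgeOf j
  unlabel∈ j nothing           _    = ∈-++⁺ˢˡ {x = zero} (subst (zero ∈_) (sym (F≡ j)) here)
  unlabel∈ j (just (a , zero)) refl = ∈-++⁺ˢˡ (subst (suc a ∈_) (sym (F≡ j)) (there (x∈⁅x⁆ a)))
  unlabel∈ j (just (a , suc t)) refl = ∈-++⁺ˢʳ {S = List.lookup F j}
    (subst (λ i → Fin.combine i t ∈ blocks j) (sym (spoke∘leaf j)) (combine∈blocks⁺ j t))

  unlabel∈⁻ : ∀ j x → unlabel x ∈ edgeOf j → OnEdge (leaf j) x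
  unlabel∈⁻ j nothing            _ = _
  unlabel∈⁻ j (just (a , zero))  p with there q ← subst (suc a ∈_) (F≡ j) (∈-++⁻ˢˡ p) = x∈⁅y⁆⇒x≡y _ q
  unlabel∈⁻ j (just (a , suc t)) p = trans (sym (leaf∘spoke a))
    (cong leaf (combine∈blocks⁻ {spoke a} {j} {t} (∈-++⁻ˢʳ {S = List.lookup F j} p)))

  expandedStar : Star (List.tabulate edgeOf) d
  expandedStar = record
    { center    = unlabel nothing
    ; edge      = edgeOf ∘ spoke
    ; edge∈H    = λ a → ∈-tabulate⁺ (spoke a)
    ; center∈   = λ a → unlabel∈ (spoke a) nothing _
    ; injective = λ {a} {b} eq → trans (unlabel∈⁻ (spoke b) (just (a , zero))
        (subst (unlabel (just (a , zero)) ∈_) eq (unlabel∈ (spoke a) (just (a , zero)) (sym (leaf∘spoke a)))))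
        (leaf∘spoke b)
    }

  module _ {n} (E : Fin d → Subset n) (c : Fin n) (∣E∣ : ∀ a → ∣ E a ∣ ≡ 2+ s) (c∈ : ∀ a → c ∈ E a)
    (meet : ∀ {a b} → a ≢ b → ∀ {v} → v ∈ E a → v ∈ E b → v ≡ c) where

    private
      -- Without the centre an edge has r - 1 vertices: one for the leaf and r - 2 for the new
      -- vertices, in any order.
      others : ∀ a → Σ[ e ∈ (Fin (suc s) → Fin n) ] Injective _≡_ _≡_ e × (∀ t → e t ∈ E a - c) ×
                     (∀ {v} → v ∈ E a - c → ∃[ t ] e t ≡ v)
      others a = enumerate (E a - c) (ℕ.suc-injective (trans (sym (∣p∣≡1+∣p-x∣ (c∈ a))) (∣E∣ a)))

    place : Label → Fin n
    place nothing        = c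
    place (just (a , t)) = proj₁ (others a) t

    place-just : ∀ a t → place (just (a , t)) ∈ E a × place (just (a , t)) ≢ c
    place-just a t = x∈p-y⇒x∈p×x≢y (E a) (proj₁ (proj₂ (proj₂ (others a))) t)

    place-injective : ∀ {x y} → place x ≡ place y → x ≡ y
    place-injective {nothing}      {nothing}      eq = refl
    place-injective {nothing}      {just (b , t)} eq = contradiction (sym eq) (proj₂ (place-just b t))
    place-injective {just (a , t)} {nothing}      eq = contradiction eq (proj₂ (place-just a t))
    place-injective {just (a , t)} {just (b , u)} eq with a Fin.≟ b
    ... | yes refl = cong (λ t → just (a , t)) (proj₁ (proj₂ (others a)) eq)
    ... | no  a≢b  = contradiction
      (meet a≢b (proj₁ (place-just a t)) (subst (_∈ E b) (sym eq) (proj₁ (place-just b u))))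
      (proj₂ (place-just a t))

    place∈ : ∀ a x → OnEdge a x → place x ∈ E a
    place∈ a nothing        _    = c∈ a
    place∈ a (just (_ , t)) refl = proj₁ (place-just a t)

    place∘label-injective : Injective _≡_ _≡_ (place ∘ label)
    place∘label-injective {v} {w} eq =
      trans (sym (unlabel-label v)) (trans (cong unlabel (place-injective {label v} {label w} eq)) (unlabel-label w))

    place∘label-image : ∀ j → IsImage (place ∘ label) (edgeOf j) (E (leaf j))
    place∘label-image j x = mk⇔ covered covers
      where
      hit : ∀ y → OnEdge (leaf j) y → place y ≡ x → ∃[ v ] v ∈ edgeOf j × place (label v) ≡ x
      hit y on eq = unlabel y , unlabel∈ j y on , trans (cong place (label-unlabel y)) eq
      covered : x ∈ E (leaf j) → ∃[ v ] v ∈ edgeOf j × place (label v) ≡ x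
      covered x∈ with x Fin.≟ c
      ... | yes x≡c = hit nothing _ (sym x≡c)
      ... | no  x≢c = let t , eq = proj₂ (proj₂ (proj₂ (others (leaf j)))) (x∈p∧x≢y⇒x∈p-y x∈ x≢c)
                      in hit (just (leaf j , t)) refl eq
      covers : (∃[ v ] v ∈ edgeOf j × place (label v) ≡ x) → x ∈ E (leaf j)
      covers (v , v∈ , refl) = place∈ (leaf j) (label v)
        (unlabel∈⁻ j (label v) (subst (_∈ edgeOf j) (sym (unlabel-label v)) v∈))

module ExpandedStar (d s : ℕ) where
  private
    length≡ : length (star d) ≡ d
    length≡ = List.length-tabulate {n = d} (λ j → inside ∷ ⁅ j ⁆)

    leaf : Fin (length (star d)) → Fin d
    leaf = Fin.cast length≡

    spoke : Fin d → Fin (length (star d))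
    spoke = Fin.cast (sym length≡)

    spoke∘leaf : ∀ j → spoke (leaf j) ≡ j
    spoke∘leaf = Fin.cast-involutive (sym length≡) length≡

  open Expanded s (star d) leaf spoke (Fin.cast-involutive length≡ (sym length≡)) spoke∘leaf
    (λ j → trans (cong (List.lookup (star d)) (sym (spoke∘leaf j)))
                 (List.lookup-tabulate (λ j → inside ∷ ⁅ j ⁆) (leaf j)))
    public

-- Passing between copies and star forests

module _ {m n} {F : Hypergraph m} {H : Hypergraph n} where
  -- Applied both ways, this shows that a copy keeps distinct edges distinct.
  image-⊆ : ∀ {φ : Fin m → Fin n} → Injective _≡_ _≡_ φ → ∀ {e f h} → IsImage φ e h → IsImage φ f h → e ⊆ f
  image-⊆ {φ} inj {e} {f} {h} he hf {x} x∈e with hf (φ x) .to (he (φ x) .from (x , x∈e , refl))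
  ... | v , v∈f , eq = subst (_∈ f) (inj eq) v∈f

  ⊑-forest : F ⊑ H → ∀ {k} {d : Fin k → ℕ} → Forest F d → Forest H d
  ⊑-forest (φ , inj , edges) T = record
    { star-at = λ i → record
      { center    = φ (center T i)
      ; edge      = λ a → proj₁ (target i a)
      ; edge∈H    = λ a → proj₁ (proj₂ (target i a))
      ; center∈   = λ a → proj₂ (proj₂ (target i a)) _ .from (center T i , Forest.center∈ T i a , refl)
      ; injective = λ {a} {b} eq → Forest.injective T i (⊆-antisym
          (image-⊆ inj (proj₂ (proj₂ (target i a))) (subst (IsImage φ _) (sym eq) (proj₂ (proj₂ (target i b)))))
          (image-⊆ inj (subst (IsImage φ _) (sym eq) (proj₂ (proj₂ (target i b)))) (proj₂ (proj₂ (target i a)))))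
      }
    ; disjoint = λ {i} {j} i≢j a b {x} p q →
        let v , v∈ , φv≡x = proj₂ (proj₂ (target i a)) x .to p
            w , w∈ , φw≡x = proj₂ (proj₂ (target j b)) x .to q
        in Forest.disjoint T i≢j a b v∈ (subst (_∈ edge T j b) (inj (trans φw≡x (sym φv≡x))) w∈)
    }
    where
    target : ∀ i a → Σ[ h ∈ Subset n ] h ∈ₗ H × IsImage φ (edge T i a) h
    target i a = let any = All.lookup edges (Forest.edge∈H T i a)
                 in List.lookup H (Any.index any) , ∈-lookup _ , Any.lookup-index any

disjointUnion-forest : ∀ {k} {n : Fin k → ℕ} (F : ∀ i → Hypergraph (n i)) {d : Fin k → ℕ} →
  (∀ i → Star (F i) (d i)) → Forest (disjointUnion F) d
disjointUnion-forest {zero} F stars = record { star-at = λ () ; disjoint = λ {i} → case i of λ () }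
disjointUnion-forest {suc k} {n} F {d} stars = record { star-at = star-at′ ; disjoint = λ {i} {j} → disjoint′ i j }
  where
  rest : Forest (disjointUnion (F ∘ suc)) (d ∘ suc)
  rest = disjointUnion-forest (F ∘ suc) (stars ∘ suc)

  star-at′ : ∀ i → Star (disjointUnion F) (d i)
  star-at′ zero = record
    { center    = Star.center (stars zero) ↑ˡ _
    ; edge      = λ a → Star.edge (stars zero) a Vec.++ ⊥
    ; edge∈H    = λ a → ∈-++⁺ˡ (∈-map⁺ _ (edge∈H (stars zero) a))
    ; center∈   = λ a → ∈-++⁺ˢˡ (center∈ (stars zero) a)
    ; injective = λ eq → injective (stars zero) (Vec.++-injectiveˡ _ _ eq)
    }
  star-at′ (suc i) = record
    { center    = n zero ↑ʳ center rest i
    ; edge      = λ a → ⊥ Vec.++ edge rest i a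
    ; edge∈H    = λ a → ∈-++⁺ʳ (List.map (Vec._++ ⊥) (F zero)) (∈-map⁺ _ (Forest.edge∈H rest i a))
    ; center∈   = λ a → ∈-++⁺ˢʳ {S = ⊥ {n zero}} (Forest.center∈ rest i a)
    ; injective = λ eq → Forest.injective rest i (Vec.++-injectiveʳ (⊥ {n zero}) ⊥ eq)
    }

  left-right : ∀ {m n} {S : Subset m} {T : Subset n} → Disjoint (S Vec.++ ⊥) (⊥ Vec.++ T)
  left-right {m} {S = S} {v = v} p q with splitView m v
  ... | left  x = ∉⊥ (∈-++⁻ˢˡ {S = ⊥} q)
  ... | right y = ∉⊥ (∈-++⁻ˢʳ {S = S} p)

  disjoint′ : ∀ i j → i ≢ j → ∀ a b → Disjoint (Star.edge (star-at′ i) a) (Star.edge (star-at′ j) b)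
  disjoint′ zero    zero    i≢j a b p q = i≢j refl
  disjoint′ zero    (suc j) i≢j a b p q = left-right {S = Star.edge (stars zero) a} {T = edge rest j b} p q
  disjoint′ (suc i) zero    i≢j a b p q = left-right {S = Star.edge (stars zero) b} {T = edge rest i a} q p
  disjoint′ (suc i) (suc j) i≢j a b {v} p q with splitView (n zero) v
  ... | left  x = ∉⊥ (∈-++⁻ˢˡ p)
  ... | right y = Forest.disjoint rest (i≢j ∘ cong suc) a b (∈-++⁻ˢʳ {S = ⊥ {n zero}} p) (∈-++⁻ˢʳ {S = ⊥ {n zero}} q)

-- The direction for the lower bound: a hypergraph without a `Forest` contains no copy.
starForest⁺⊑⇒forest : ∀ s {k} {d : Fin k → ℕ} {n} {H : Hypergraph n} → starForest⁺ (2+ s) d ⊑ H → Forest H d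
starForest⁺⊑⇒forest s {d = d} F⊑H =
  ⊑-forest F⊑H (disjointUnion-forest _ (λ i → ExpandedStar.expandedStar (d i) s))

isImage-cong : ∀ {m n} {φ ψ : Fin m → Fin n} → (∀ v → φ v ≡ ψ v) → ∀ {e h} → IsImage φ e h → IsImage ψ e h
isImage-cong φ≗ψ im x = mk⇔
  (λ x∈ → let v , v∈ , eq = im x .to x∈ in v , v∈ , trans (sym (φ≗ψ v)) eq)
  (λ (v , v∈ , eq) → im x .from (v , v∈ , trans (φ≗ψ v) eq))

module _ {N} (H : Hypergraph N) where
  private
    Embeds : ∀ {m} → Hypergraph m → (Fin m → Fin N) → Set
    Embeds F φ = All (λ e → Any (IsImage φ e) H) F

    extendˡ : ∀ {m n} {φ : Fin (m + n) → Fin N} {e : Subset m} {h} →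
              IsImage (φ ∘ (_↑ˡ n)) e h → IsImage φ (e Vec.++ ⊥) h
    extendˡ {m} {n} {φ} {e} {h} im x = mk⇔
      (λ x∈h → let v , v∈ , eq = im x .to x∈h in v ↑ˡ _ , ∈-++⁺ˢˡ v∈ , eq)
      back
      where
      back : (∃[ v ] v ∈ e Vec.++ ⊥ × φ v ≡ x) → x ∈ h
      back (v , v∈ , eq) with splitView m v
      ... | left  y = im x .from (y , ∈-++⁻ˢˡ v∈ , eq)
      ... | right y = contradiction (∈-++⁻ˢʳ {S = e} v∈) ∉⊥

    extendʳ : ∀ {m n} {φ : Fin (m + n) → Fin N} {e : Subset n} {h} →
              IsImage (φ ∘ (m ↑ʳ_)) e h → IsImage φ (⊥ Vec.++ e) h
    extendʳ {m} {n} {φ} {e} {h} im x = mk⇔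
      (λ x∈h → let v , v∈ , eq = im x .to x∈h in m ↑ʳ v , ∈-++⁺ˢʳ {S = ⊥ {m}} v∈ , eq)
      back
      where
      back : (∃[ v ] v ∈ ⊥ Vec.++ e × φ v ≡ x) → x ∈ h
      back (v , v∈ , eq) with splitView m v
      ... | left  y = contradiction (∈-++⁻ˢˡ v∈) ∉⊥
      ... | right y = im x .from (y , ∈-++⁻ˢʳ {S = ⊥ {m}} v∈ , eq)

  disjointUnion-⊑ : ∀ {k} {n : Fin k → ℕ} (F : ∀ i → Hypergraph (n i)) (φ : ∀ i → Fin (n i) → Fin N) →
    (∀ i → Injective _≡_ _≡_ (φ i)) → (∀ {i j} → i ≢ j → ∀ v w → φ i v ≢ φ j w) →
    (∀ i → All (λ e → Any (IsImage (φ i) e) H) (F i)) → disjointUnion F ⊑ H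
  disjointUnion-⊑ F φ inj apart emb =
    let ψ , ψ-inj , ψ-emb , _ = go F φ inj apart emb in ψ , ψ-inj , ψ-emb
    where
    -- The induction also carries that each value of `ψ` is a value of some `φ i`. This keeps the
    -- image of the first component apart from the rest.
    go : ∀ {k} {n : Fin k → ℕ} (F : ∀ i → Hypergraph (n i)) (φ : ∀ i → Fin (n i) → Fin N) →
      (∀ i → Injective _≡_ _≡_ (φ i)) → (∀ {i j} → i ≢ j → ∀ v w → φ i v ≢ φ j w) →
      (∀ i → Embeds (F i) (φ i)) →
      Σ[ ψ ∈ (Fin (Vector.foldr _+_ 0 n) → Fin N) ]
        Injective _≡_ _≡_ ψ × Embeds (disjointUnion F) ψ × (∀ w → ∃[ i ] ∃[ v ] ψ w ≡ φ i v)
    go {zero}      F φ inj apart emb = (λ ()) , (λ {x} → case x of λ ()) , [] , λ ()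
    go {suc k} {n} F φ inj apart emb
      with go (F ∘ suc) (φ ∘ suc) (inj ∘ suc) (λ i≢j → apart (i≢j ∘ Fin.suc-injective)) (emb ∘ suc)
    ... | ψ , ψ-inj , ψ-emb , ψ-range = θ , (λ {v} {w} → θ-inj v w) ,
      All.++⁺ (All.map⁺ (All.map (Any.map (extendˡ ∘ isImage-cong (sym ∘ θˡ))) (emb zero)))
              (All.map⁺ (All.map (Any.map (extendʳ ∘ isImage-cong (sym ∘ θʳ))) ψ-emb)) ,
      θ-range
      where
      θ : Fin (n zero + Vector.foldr _+_ 0 (n ∘ suc)) → Fin N
      θ = [ φ zero , ψ ]′ ∘ Fin.splitAt (n zero)
      θˡ : ∀ x → θ (x ↑ˡ _) ≡ φ zero x
      θˡ x rewrite Fin.splitAt-↑ˡ (n zero) x (Vector.foldr _+_ 0 (n ∘ suc)) = refl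
      θʳ : ∀ y → θ (n zero ↑ʳ y) ≡ ψ y
      θʳ y rewrite Fin.splitAt-↑ʳ (n zero) (Vector.foldr _+_ 0 (n ∘ suc)) y = refl
      φ≢ψ : ∀ x y → φ zero x ≢ ψ y
      φ≢ψ x y eq = let i , v , eq′ = ψ-range y in apart (λ ()) x v (trans eq eq′)
      θ-inj : ∀ v w → θ v ≡ θ w → v ≡ w
      θ-inj v w eq with splitView (n zero) v | splitView (n zero) w
      ... | left x  | left y  = cong (_↑ˡ _) (inj zero (trans (sym (θˡ x)) (trans eq (θˡ y))))
      ... | left x  | right y = contradiction (trans (sym (θˡ x)) (trans eq (θʳ y))) (φ≢ψ x y)
      ... | right x | left y  = contradiction (sym (trans (sym (θʳ x)) (trans eq (θˡ y)))) (φ≢ψ y x)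
      ... | right x | right y = cong (n zero ↑ʳ_) (ψ-inj (trans (sym (θʳ x)) (trans eq (θʳ y))))
      θ-range : ∀ w → ∃[ i ] ∃[ v ] θ w ≡ φ i v
      θ-range w with splitView (n zero) w
      ... | left x  = zero , x , θˡ x
      ... | right y = let i , v , eq = ψ-range y in suc i , v , trans (θʳ y) eq

  -- The direction for the upper bound. Linearity makes the edges of a star meet only in the centre,
  -- and `d i ≥ 1` puts every vertex of the i-th expanded star, the centre included, on an edge, so
  -- that disjoint edges give disjoint images.
  forest⇒starForest⁺⊑ : ∀ s {k} {d : Fin k → ℕ} → (∀ i → 1 ≤ d i) →
    Uniform (2+ s) H → IsLinear (List.lookup H) → Forest H d → starForest⁺ (2+ s) d ⊑ H
  forest⇒starForest⁺⊑ s {k} {d} d≥1 unif lin T = disjointUnion-⊑ _ φ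
    (λ i → ES.place∘label-injective i (edge T i) (center T i) (size i) (Forest.center∈ T i) (meet i))
    apart
    (λ i → All.tabulate⁺ λ j → find (Forest.edge∈H T i _)
      (ES.place∘label-image i (edge T i) (center T i) (size i) (Forest.center∈ T i) (meet i) j))
    where
    module ES i = ExpandedStar (d i) s
    size : ∀ i a → ∣ edge T i a ∣ ≡ 2+ s
    size i a = All.lookup unif (Forest.edge∈H T i a)
    meet : ∀ i {a b} → a ≢ b → ∀ {v} → v ∈ edge T i a → v ∈ edge T i b → v ≡ center T i
    meet i {a} {b} a≢b {v} p q with v Fin.≟ center T i
    ... | yes eq = eq
    ... | no  v≢c = contradiction (Forest.injective T i (trans (Any.lookup-index (Forest.edge∈H T i a))
      (trans (cong (List.lookup H) (lin v≢c
        (subst (v ∈_) (Any.lookup-index (Forest.edge∈H T i a)) p)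
        (subst (center T i ∈_) (Any.lookup-index (Forest.edge∈H T i a)) (Forest.center∈ T i a))
        (subst (v ∈_) (Any.lookup-index (Forest.edge∈H T i b)) q)
        (subst (center T i ∈_) (Any.lookup-index (Forest.edge∈H T i b)) (Forest.center∈ T i b))))
      (sym (Any.lookup-index (Forest.edge∈H T i b)))))) a≢b
    φ : ∀ i → ES.Vertex i → Fin N
    φ i = ES.place i (edge T i) (center T i) (size i) (Forest.center∈ T i) (meet i) ∘ ES.label i
    onSomeEdge : ∀ i x → ∃[ a ] ES.OnEdge i a x
    onSomeEdge i nothing        = Fin.fromℕ< (d≥1 i) , _
    onSomeEdge i (just (a , _)) = a , refl
    covered : ∀ i v → ∃[ a ] φ i v ∈ edge T i a
    covered i v = let a , on = onSomeEdge i (ES.label i v)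
                  in a , ES.place∈ i _ _ (size i) _ (meet i) a (ES.label i v) on
    apart : ∀ {i j} → i ≢ j → ∀ v w → φ i v ≢ φ j w
    apart i≢j v w eq = let a , p = covered _ v; b , q = covered _ w
                       in Forest.disjoint T i≢j a b p (subst (_∈ edge T _ b) (sym eq) q)
    find : ∀ {m} {φ : Fin m → Fin N} {e h} → h ∈ₗ H → IsImage φ e h → Any (IsImage φ e) H
    find h∈ im = Any.map (λ eq → subst (IsImage _ _) eq im) h∈

-- Greedy search for star forests

-- As r ≥ 2, an edge contains two vertices, and these determine its index.
uniform-linear⇒injective : ∀ {s m n} {E : Fin m → Subset n} → IsUniform (2+ s) E → IsLinear E → Injective _≡_ _≡_ E
uniform-linear⇒injective {E = E} unif lin {i} {j} eq =
  let e , inj , e∈ , _ = enumerate (E i) (unif i)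
      e∈j = λ t → subst (e t ∈_) eq (e∈ t)
  in lin (λ e₀≡e₁ → case inj e₀≡e₁ of λ ()) (e∈ zero) (e∈ (suc zero)) (e∈j zero) (e∈j (suc zero))

≤∑ : ∀ {k} (f : Fin k → ℕ) i → f i ≤ sum f
≤∑ f zero    = ℕ.m≤m+n _ _
≤∑ f (suc i) = ℕ.≤-trans (≤∑ (f ∘ suc) i) (ℕ.m≤n+m _ _)

module Greedy {n} (s : ℕ) (H : Hypergraph n)
  (unif : IsUniform (2+ s) (List.lookup H)) (lin : IsLinear (List.lookup H)) where

  r : ℕ
  r = 2+ s

  E : Fin (length H) → Subset n
  E = List.lookup H

  open Counting E

  starAvoiding : ∀ {d} W v → d ≤ deg W v → Σ[ S ∈ Star H d ] ∀ a → Disjoint (Star.edge S a) W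
  starAvoiding W v d≤ =
    let e , inj , e∈ = choose (through v ∩ avoiding W) d≤ in
    record
      { center    = v
      ; edge      = E ∘ e
      ; edge∈H    = λ a → ∈-lookup (e a)
      ; center∈   = λ a → ∈through⁻ (proj₁ (x∈p∩q⁻ _ _ (e∈ a)))
      ; injective = inj ∘ uniform-linear⇒injective unif lin
      } ,
    λ a → ∈avoiding⁻ {W} (proj₂ (x∈p∩q⁻ (through v) _ (e∈ a)))

  star-size : ∀ {d} (S : Star H d) → ∣ ⋃ᶠ (Star.edge S) ∣ ≤ d * r
  star-size S = ∣⋃ᶠ∣≤ (Star.edge S) (λ a → ℕ.≤-reflexive
    (All.lookup {P = λ e → ∣ e ∣ ≡ r} (subst (All _) (List.tabulate-lookup H) (All.tabulate⁺ unif)) (edge∈H S a)))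

  -- By linearity each vertex of W spoils at most one edge through v.
  ∣through∣≤deg+∣W∣ : ∀ W v → v ∉ W → ∣ through v ∣ ≤ deg W v + ∣ W ∣
  ∣through∣≤deg+∣W∣ W v v∉W = begin
    ∣ through v ∣
      ≤⟨ p⊆q⇒∣p∣≤∣q∣ split ⟩
    ∣ (through v ∩ avoiding W) ∪ (through v ∩ ∁ (avoiding W)) ∣
      ≤⟨ ∣∪∣≤ (through v ∩ avoiding W) (through v ∩ ∁ (avoiding W)) ⟩
    deg W v + ∣ spoiled ∣
      ≤⟨ ℕ.+-monoʳ-≤ (deg W v) (injective⇒≤∣∣ W {proj₁ ∘ spoiler} spoiler-injective (proj₂ ∘ proj₂ ∘ spoiler)) ⟩
    deg W v + ∣ W ∣ ∎
    where
    open ℕ.≤-Reasoning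
    spoiled = through v ∩ ∁ (avoiding W)
    split : through v ⊆ (through v ∩ avoiding W) ∪ spoiled
    split {j} j∈ with j ∈? avoiding W
    ... | yes p = x∈p∪q⁺ (inj₁ (x∈p∩q⁺ (j∈ , p)))
    ... | no ¬p = x∈p∪q⁺ (inj₂ (x∈p∩q⁺ (j∈ , x∉p⇒x∈∁p ¬p)))
    spoiler : ∀ a → ∃[ w ] w ∈ E (enum spoiled a) × w ∈ W
    spoiler a = let w , w∈ = ¬disjoint⇒common _ W λ dis →
                      x∈∁p⇒x∉p (proj₂ (x∈p∩q⁻ (through v) _ (enum-∈ spoiled a))) (∈avoiding⁺ {W} dis)
                in w , x∈p∩q⁻ _ W w∈
    v∈ : ∀ a → v ∈ E (enum spoiled a)
    v∈ a = ∈through⁻ (proj₁ (x∈p∩q⁻ _ _ (enum-∈ spoiled a)))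
    spoiler-injective : Injective _≡_ _≡_ (proj₁ ∘ spoiler)
    spoiler-injective {a} {b} eq = enum-injective spoiled (lin
      (λ w≡v → v∉W (subst (_∈ W) w≡v (proj₂ (proj₂ (spoiler a)))))
      (proj₁ (proj₂ (spoiler a))) (v∈ a) (subst (_∈ E _) (sym eq) (proj₁ (proj₂ (spoiler b)))) (v∈ b))

  -- A crude bound on the number of vertices of the forest: the centre is counted once per edge.
  weight : ∀ {k} → (Fin k → ℕ) → ℕ
  weight d = sum (λ i → d i * r)

  record ForestAvoiding {k} (W : Subset n) (d : Fin k → ℕ) : Set where
    field
      forest          : Forest H d
      support         : Subset n
      ∣support∣≤      : ∣ support ∣ ≤ weight d
      support-avoids  : Disjoint support W
      edge⊆support    : ∀ i a → edge forest i a ⊆ support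

  open ForestAvoiding

  empty-forest : ∀ {W} {d : Fin 0 → ℕ} → ForestAvoiding W d
  empty-forest = record
    { forest         = record { star-at = λ () ; disjoint = λ {i} → case i of λ () }
    ; support        = ⊥
    ; ∣support∣≤     = ℕ.≤-reflexive (∣⊥∣≡0 n)
    ; support-avoids = λ v∈ → contradiction v∈ ∉⊥
    ; edge⊆support   = λ ()
    }

  -- The rest of the forest avoids a larger set `W′` than the new star: in `greedy` it also keeps
  -- off the vertices of that star, in `add-hub` off the hub, which the new star has to use.
  add-star : ∀ {k W W′} {d : Fin (suc k) → ℕ} → W ⊆ W′ → (T : ForestAvoiding W′ (d ∘ suc)) (S : Star H (d zero)) →
    (∀ a → Disjoint (Star.edge S a) W) → (∀ a → Disjoint (Star.edge S a) (support T)) → ForestAvoiding W d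
  add-star {W = W} {d = d} W⊆W′ T S S-W S-T = record
    { forest = record
      { star-at  = star-at′
      ; disjoint = λ {i} {j} → disjoint′ i j }
    ; support        = ⋃ᶠ (Star.edge S) ∪ support T
    ; ∣support∣≤     = ℕ.≤-trans (∣∪∣≤ (⋃ᶠ (Star.edge S)) (support T)) (ℕ.+-mono-≤ (star-size S) (∣support∣≤ T))
    ; support-avoids = λ v∈ v∈W → [ (λ p → let a , q = ∈⋃ᶠ⁻ _ p in S-W a q v∈W)
                                  , (λ p → support-avoids T p (W⊆W′ v∈W)) ]′ (x∈p∪q⁻ _ _ v∈)
    ; edge⊆support   = λ { zero    a v∈ → x∈p∪q⁺ (inj₁ (∈⋃ᶠ (Star.edge S) a v∈))
                         ; (suc i) a v∈ → x∈p∪q⁺ (inj₂ (edge⊆support T i a v∈)) }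
    }
    where
    star-at′ : ∀ i → Star H (d i)
    star-at′ zero    = S
    star-at′ (suc i) = star-at (forest T) i
    disjoint′ : ∀ i j → i ≢ j → ∀ a b → Disjoint (Star.edge (star-at′ i) a) (Star.edge (star-at′ j) b)
    disjoint′ zero    zero    i≢j a b p q = i≢j refl
    disjoint′ zero    (suc j) i≢j a b p q = S-T a p (edge⊆support T j b q)
    disjoint′ (suc i) zero    i≢j a b p q = S-T b q (edge⊆support T i a p)
    disjoint′ (suc i) (suc j) i≢j a b p q = disjoint (forest T) (i≢j ∘ cong suc) a b p q

  -- The first `b` stars are reserved for the hubs. Used vertices therefore come only from the stars
  -- numbered from `b` to below `index`, at most `c` from each.
  record Stuck {k} (c b : ℕ) (W : Subset n) (d : Fin k → ℕ) : Set where
    field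
      index     : Fin k
      b≤index   : b ≤ toℕ index
      used      : Subset n
      ∣used∣≤   : ∣ used ∣ ≤ (toℕ index ∸ b) * c
      deg<      : ∀ v → deg (W ∪ used) v < d index

  open Stuck

  greedy : ∀ {k} c (d : Fin k → ℕ) → (∀ i → d i * r ≤ c) → ∀ W → ForestAvoiding W d ⊎ Stuck c 0 W d
  greedy {zero}  c d d≤c W = inj₁ empty-forest
  greedy {suc k} c d d≤c W with Fin.any? (λ v → d zero ℕ.≤? deg W v)
  ... | no none = inj₂ record
    { index   = zero
    ; b≤index = z≤n
    ; used    = ⊥
    ; ∣used∣≤ = ℕ.≤-reflexive (∣⊥∣≡0 n)
    ; deg<    = λ v → subst (λ X → deg X v < d zero) (sym (∪-identityʳ W)) (ℕ.≰⇒> (none ∘ (v ,_)))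
    }
  ... | yes (v , d≤) with starAvoiding W v d≤
  ... | S , S-W with greedy c (d ∘ suc) (d≤c ∘ suc) (W ∪ ⋃ᶠ (Star.edge S))
  ... | inj₁ T = inj₁ (add-star (p⊆p∪q _) T S S-W
    λ a p q → support-avoids T q (x∈p∪q⁺ (inj₂ (∈⋃ᶠ (Star.edge S) a p))))
  ... | inj₂ st = inj₂ record
    { index   = suc (index st)
    ; b≤index = z≤n
    ; used    = V ∪ used st
    ; ∣used∣≤ = ℕ.≤-trans (∣∪∣≤ V (used st)) (ℕ.+-mono-≤ (ℕ.≤-trans (star-size S) (d≤c zero)) (∣used∣≤ st))
    ; deg<    = λ v → subst (λ X → deg X v < d (suc (index st))) (∪-assoc W V (used st)) (deg< st v)
    }
    where V = ⋃ᶠ (Star.edge S)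

  -- The rest was found off `h`, so `h` lies outside `W ∪ support T`, and each vertex of this set
  -- spoils at most one edge at `h`. There are at most `∣ W ∣ + weight (d ∘ suc)` of them, and the
  -- assumed degree exceeds this by at least `d zero`.
  add-hub : ∀ {k W} {d : Fin (suc k) → ℕ} h → h ∉ W → ∣ W ∣ + suc k + weight d ≤ ∣ through h ∣ →
    ForestAvoiding (W ∪ ⁅ h ⁆) (d ∘ suc) → ForestAvoiding W d
  add-hub {k} {W} {d} h h∉W large T =
    let S , S-avoids = starAvoiding (W ∪ support T) h enough
    in add-star (p⊆p∪q _) T S (λ a p q → S-avoids a p (x∈p∪q⁺ (inj₁ q))) (λ a p q → S-avoids a p (x∈p∪q⁺ (inj₂ q)))
    where
    open ℕ.≤-Reasoning
    h∉ : h ∉ W ∪ support T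
    h∉ p = [ h∉W , (λ q → support-avoids T q (x∈p∪q⁺ (inj₂ (x∈⁅x⁆ h)))) ]′ (x∈p∪q⁻ W _ p)
    rearrange : ∀ d₀ w k y → d₀ + (w + y) + k ≡ w + k + (d₀ + y)
    rearrange = solve-∀
    enough : d zero ≤ deg (W ∪ support T) h
    enough = ℕ.+-cancelʳ-≤ (∣ W ∪ support T ∣) _ _ (begin
      d zero + ∣ W ∪ support T ∣
        ≤⟨ ℕ.+-monoʳ-≤ (d zero) (ℕ.≤-trans (∣∪∣≤ W (support T)) (ℕ.+-monoʳ-≤ ∣ W ∣ (∣support∣≤ T))) ⟩
      d zero + (∣ W ∣ + weight (d ∘ suc))
        ≤⟨ ℕ.m≤m+n _ _ ⟩
      d zero + (∣ W ∣ + weight (d ∘ suc)) + suc k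
        ≡⟨ rearrange (d zero) (∣ W ∣) (suc k) (weight (d ∘ suc)) ⟩
      ∣ W ∣ + suc k + (d zero + weight (d ∘ suc))
        ≤⟨ ℕ.+-monoʳ-≤ (∣ W ∣ + suc k) (ℕ.+-monoˡ-≤ _ (ℕ.m≤m*n (d zero) r)) ⟩
      ∣ W ∣ + suc k + weight d
        ≤⟨ large ⟩
      ∣ through h ∣
        ≤⟨ ∣through∣≤deg+∣W∣ (W ∪ support T) h h∉ ⟩
      deg (W ∪ support T) h + ∣ W ∪ support T ∣ ∎)

  shift-stuck : ∀ {k c b W X} {d : Fin (suc k) → ℕ} h → Stuck c b ((W ∪ ⁅ h ⁆) ∪ X) (d ∘ suc) →
    Stuck c (suc b) (W ∪ (⁅ h ⁆ ∪ X)) d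
  shift-stuck {W = W} {X} {d} h st = record
    { index   = suc (index st)
    ; b≤index = s≤s (b≤index st)
    ; used    = used st
    ; ∣used∣≤ = ∣used∣≤ st
    ; deg<    = λ v → subst (λ Y → deg (Y ∪ used st) v < d (suc (index st))) (∪-assoc W ⁅ h ⁆ X) (deg< st v)
    }

  -- The stars at the b vertices of large degree are placed last: a stuck
  -- search then uses only vertices of the stars d_{b+1}, d_{b+2}, ….
  greedy-with-hubs : ∀ {k b} c (d : Fin k → ℕ) → (∀ i → d i * r ≤ c) → b ≤ k →
    (hub : Fin b → Fin n) → Injective _≡_ _≡_ hub → ∀ W → (∀ i → hub i ∉ W) →
    (∀ i → ∣ W ∣ + k + weight d ≤ ∣ through (hub i) ∣) →
    ForestAvoiding W d ⊎ Stuck c b (W ∪ ⋃ᶠ (⁅_⁆ ∘ hub)) d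
  greedy-with-hubs {b = zero} c d d≤c _ hub inj W hub∉W large =
    subst (λ X → ForestAvoiding W d ⊎ Stuck c 0 X d) (sym (∪-identityʳ W)) (greedy c d d≤c W)
  greedy-with-hubs {suc k} {suc b} c d d≤c (s≤s b≤k) hub inj W hub∉W large =
    Sum.map (add-hub (hub zero) (hub∉W zero) (large zero)) (shift-stuck (hub zero))
      (greedy-with-hubs c (d ∘ suc) (d≤c ∘ suc) b≤k (hub ∘ suc) (Fin.suc-injective ∘ inj) (W ∪ ⁅ hub zero ⁆)
        (λ i p → [ hub∉W (suc i) , (λ q → case inj (x∈⁅y⁆⇒x≡y _ q) of λ ()) ]′ (x∈p∪q⁻ W _ p))
        (λ i → ℕ.≤-trans (grow (d zero * r)) (large (suc i))))
    where
    open ℕ.≤-Reasoning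
    rearrange : ∀ w k x y → w + 1 + k + y + x ≡ w + (1 + k) + (x + y)
    rearrange = solve-∀
    -- Reserving a hub enlarges the forbidden set by one while the number of stars still wanted
    -- drops by one. The summand `k` in the degree requirement is there for this exchange.
    grow : ∀ x → ∣ W ∪ ⁅ hub zero ⁆ ∣ + k + weight (d ∘ suc) ≤ ∣ W ∣ + suc k + (x + weight (d ∘ suc))
    grow x = begin
      ∣ W ∪ ⁅ hub zero ⁆ ∣ + k + weight (d ∘ suc)
        ≤⟨ ℕ.+-monoˡ-≤ _ (ℕ.+-monoˡ-≤ k (∣∪∣≤ W ⁅ hub zero ⁆)) ⟩
      ∣ W ∣ + ∣ ⁅ hub zero ⁆ ∣ + k + weight (d ∘ suc)
        ≡⟨ cong (λ o → ∣ W ∣ + o + k + weight (d ∘ suc)) (∣⁅x⁆∣≡1 (hub zero)) ⟩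
      ∣ W ∣ + 1 + k + weight (d ∘ suc)
        ≤⟨ ℕ.m≤m+n _ x ⟩
      ∣ W ∣ + 1 + k + weight (d ∘ suc) + x
        ≡⟨ rearrange ∣ W ∣ k x _ ⟩
      ∣ W ∣ + suc k + (x + weight (d ∘ suc)) ∎

-- Upper bound

lookup-AllPairs : ∀ {A : Set} {R : A → A → Set} → (∀ {x y} → R x y → R y x) → ∀ {xs} → AllPairs R xs →
  ∀ {i j} → i ≢ j → R (List.lookup xs i) (List.lookup xs j)
lookup-AllPairs sym-R (Rx ∷ Rxs) {zero}  {zero}  i≢j = contradiction refl i≢j
lookup-AllPairs sym-R (Rx ∷ Rxs) {zero}  {suc j} i≢j = All.lookup Rx (∈-lookup j)
lookup-AllPairs sym-R (Rx ∷ Rxs) {suc i} {zero}  i≢j = sym-R (All.lookup Rx (∈-lookup i))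
lookup-AllPairs sym-R (Rx ∷ Rxs) {suc i} {suc j} i≢j = lookup-AllPairs sym-R Rxs (i≢j ∘ cong suc)

two-elements : ∀ {n} (S : Subset n) {u v} → u ∈ S → v ∈ S → u ≢ v → 2 ≤ ∣ S ∣
two-elements S {u} {v} u∈ v∈ u≢v
  rewrite ∣p∣≡1+∣p-x∣ u∈ | ∣p∣≡1+∣p-x∣ (x∈p∧x≢y⇒x∈p-y v∈ (u≢v ∘ sym)) = s≤s (s≤s z≤n)

Linear⇒IsLinear : ∀ {n} {H : Hypergraph n} → Linear H → IsLinear (List.lookup H)
Linear⇒IsLinear {H = H} lin {i} {j} {u} {v} u≢v ui vi uj vj with i Fin.≟ j
... | yes i≡j = i≡j
... | no  i≢j = contradiction
  (two-elements (List.lookup H i ∩ List.lookup H j) (x∈p∩q⁺ (ui , uj)) (x∈p∩q⁺ (vi , vj)) u≢v)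
  (ℕ.≤⇒≯ (lookup-AllPairs (λ {e} {f} → subst (_≤ 1) (cong ∣_∣ (∩-comm e f))) lin i≢j))

-- r (r - 1) times the term with number j of the bound, for n ≥ j.
scaledTerm : ℕ → ∀ {k} → (Fin k → ℕ) → ℕ → Fin k → ℕ
scaledTerm r d n j = ((d j ∸ 1) * (r ∸ 1) + toℕ j * r) * (n ∸ toℕ j) + toℕ j * (toℕ j ∸ 1)

module Upper (s : ℕ) {k} (d : Fin k → ℕ) where

  -- `w` bounds the vertices of the whole forest, and `D` is the degree that `greedy-with-hubs`
  -- demands of hubs when `W` is empty. `N - k` collects the constants of `arithmetic`: from
  -- replacing n - b by n - j + k in the edges avoiding the hubs, from doing so in the edges meeting
  -- them, and from at most k w used vertices of degree at most `D`.
  r w D N : ℕ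
  r = 2+ s
  w = sum (λ i → d i * r)
  D = k + w
  N = k + (k * (w * suc s) + k * (k + r * k) + k * w * D * (r * suc s))

  d*r≤w : ∀ i → d i * r ≤ w
  d*r≤w = ≤∑ (λ i → d i * r)

  d≤w : ∀ i → d i ≤ w
  d≤w i = ℕ.≤-trans (ℕ.m≤m*n (d i) r) (d*r≤w i)

  module _ {n} (N≤n : N ≤ n) (H : Hypergraph n)
    (unif : Uniform r H) (lin : IsLinear (List.lookup H)) where

    private
      unif′ : IsUniform r (List.lookup H)
      unif′ j = All.lookup unif (∈-lookup j)

    open Greedy s H unif′ lin using (ForestAvoiding; Stuck; greedy-with-hubs)
    open Counting (List.lookup H)

    hub? : ∀ v → Dec (D ≤ ∣ through v ∣)
    hub? v = D ℕ.≤? ∣ through v ∣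

    hubs : Subset n
    hubs = ⟪ hub? ⟫

    -- Three kinds of edges are bounded separately: those avoiding hubs and used vertices, by their
    -- degrees below `d index`; those meeting a hub, by weighted pairs; those meeting a used vertex,
    -- by the degree threshold `D`.
    stuck-bound : (st : Stuck w (∣ hubs ∣) hubs d) →
                  length H * (r * (r ∸ 1)) ≤ scaledTerm r d n (Stuck.index st)
    stuck-bound st = begin
      m * (r * suc s)
        ≤⟨ ℕ.*-monoˡ-≤ (r * suc s) (m≤avoiding+meeting (hubs ∪ used)) ⟩
      (∣ avoiding (hubs ∪ used) ∣ + ∣ meeting (hubs ∪ used) ∣) * (r * suc s)
        ≤⟨ ℕ.*-monoˡ-≤ (r * suc s) (ℕ.+-monoʳ-≤ (∣ avoiding (hubs ∪ used) ∣) meeting≤) ⟩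
      (∣ avoiding (hubs ∪ used) ∣ + (∣ meeting hubs ∣ + ∣ used ∣ * D)) * (r * suc s)
        ≡⟨ distribute (∣ avoiding (hubs ∪ used) ∣) (∣ meeting hubs ∣) (∣ used ∣ * D) r (suc s) ⟩
      ∣ avoiding (hubs ∪ used) ∣ * r * suc s + ∣ meeting hubs ∣ * (r * suc s) + ∣ used ∣ * D * (r * suc s)
        ≤⟨ ℕ.+-mono-≤ (ℕ.+-mono-≤
             (ℕ.*-monoˡ-≤ (suc s) (avoiding-bound unif′ hubs (hubs ∪ used) (p⊆p∪q used)
               (λ v → ℕ.<⇒≤pred (deg< v))))
             (meeting-quadratic (s≤s z≤n) unif′ lin hubs))
             (ℕ.*-monoˡ-≤ (r * suc s) (ℕ.*-monoˡ-≤ D ∣used∣≤)) ⟩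
      (n ∸ b) * a * suc s + b * (b ∸ 1 + r * (n ∸ b)) + (j ∸ b) * w * D * (r * suc s)
        ≤⟨ arithmetic (ℕ.m≤n⇒m<n∨m≡n b≤index) ⟩
      (a * suc s + j * r) * (n ∸ j) + j * (j ∸ 1) ∎
      where
      open ℕ.≤-Reasoning
      open Stuck st
      m = length H
      b = ∣ hubs ∣
      j = toℕ index
      a = ℕ.pred (d index)

      distribute : ∀ x y z r t → (x + (y + z)) * (r * t) ≡ x * r * t + y * (r * t) + z * (r * t)
      distribute = solve-∀

      few : ∀ {u} → u ∈ used ∩ ∁ hubs → ∣ through u ∣ ≤ D
      few u∈ = ℕ.<⇒≤ (ℕ.≰⇒> λ D≤ → x∈∁p⇒x∉p (proj₂ (x∈p∩q⁻ used _ u∈)) (∈⟪⟫⁺ hub? D≤))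

      -- `Stuck` does not record that used vertices are no hubs, and the degree bound `D` holds only
      -- for those that are not.
      same-union : hubs ∪ used ≡ hubs ∪ (used ∩ ∁ hubs)
      same-union = trans (sym (∩-identityʳ _)) (trans (cong ((hubs ∪ used) ∩_) (sym (p∪∁p≡⊤ hubs)))
                     (sym (∪-distribˡ-∩ hubs used (∁ hubs))))

      meeting≤ : ∣ meeting (hubs ∪ used) ∣ ≤ ∣ meeting hubs ∣ + ∣ used ∣ * D
      meeting≤ = begin
        ∣ meeting (hubs ∪ used) ∣                      ≡⟨ cong (∣_∣ ∘ meeting) same-union ⟩
        ∣ meeting (hubs ∪ (used ∩ ∁ hubs)) ∣           ≤⟨ meeting-∪ hubs (used ∩ ∁ hubs) ⟩
        ∣ meeting hubs ∣ + ∣ meeting (used ∩ ∁ hubs) ∣ ≤⟨ ℕ.+-monoʳ-≤ _ (meeting-bound (used ∩ ∁ hubs) few) ⟩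
        ∣ meeting hubs ∣ + ∣ used ∩ ∁ hubs ∣ * D       ≤⟨ ℕ.+-monoʳ-≤ _ (ℕ.*-monoˡ-≤ D (∣p∩q∣≤∣p∣ used (∁ hubs))) ⟩
        ∣ meeting hubs ∣ + ∣ used ∣ * D                ∎

      j≤k : j ≤ k
      j≤k = ℕ.<⇒≤ (Fin.toℕ<n index)

      arithmetic : b < j ⊎ b ≡ j →
        (n ∸ b) * a * suc s + b * (b ∸ 1 + r * (n ∸ b)) + (j ∸ b) * w * D * (r * suc s)
          ≤ (a * suc s + j * r) * (n ∸ j) + j * (j ∸ 1)
      arithmetic (inj₂ b≡j) rewrite b≡j | ℕ.n∸n≡0 j = ℕ.≤-reflexive (identity (n ∸ j) a (suc s) j (j ∸ 1) r)
        where
        identity : ∀ x a t j j′ r → x * a * t + j * (j′ + r * x) + 0 ≡ (a * t + j * r) * x + j * j′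
        identity = solve-∀
      arithmetic (inj₁ b<j) = begin
        (n ∸ b) * a * t + b * (b ∸ 1 + r * (n ∸ b)) + (j ∸ b) * w * D * (r * t)
          ≤⟨ ℕ.+-mono-≤ (ℕ.+-mono-≤
               (ℕ.*-monoˡ-≤ t (ℕ.*-monoˡ-≤ a n∸b≤))
               (ℕ.*-mono-≤ {x = b} {y = pj} (ℕ.<⇒≤pred b<j) (ℕ.+-mono-≤ b∸1≤k (ℕ.*-monoʳ-≤ r n∸b≤))))
               (ℕ.*-monoˡ-≤ (r * t) (ℕ.*-monoˡ-≤ D (ℕ.*-monoˡ-≤ w (ℕ.≤-trans (ℕ.m∸n≤m j b) j≤k)))) ⟩
        (x + k) * a * t + pj * (k + r * (x + k)) + k * w * D * (r * t)
          ≡⟨ regroup x k a t pj r (k * w * D * (r * t)) ⟩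
        (a * t + pj * r) * x + (k * (a * t) + pj * (k + r * k) + k * w * D * (r * t))
          ≤⟨ ℕ.+-monoʳ-≤ ((a * t + pj * r) * x) (ℕ.+-monoˡ-≤ _ (ℕ.+-mono-≤
               (ℕ.*-monoʳ-≤ k (ℕ.*-monoˡ-≤ t (ℕ.≤-trans (ℕ.pred[n]≤n {d index}) (d≤w index))))
               (ℕ.*-monoˡ-≤ (k + r * k) (ℕ.≤-trans (ℕ.pred[n]≤n {j}) j≤k)))) ⟩
        -- Only j - 1 hubs have been charged so far. The share `r * x` of the missing one swallows
        -- all constants, as `N ≤ n` gives `x ≥ N - k`.
        (a * t + pj * r) * x + (k * (w * t) + k * (k + r * k) + k * w * D * (r * t))
          ≤⟨ ℕ.+-monoʳ-≤ ((a * t + pj * r) * x) (ℕ.≤-trans slack (ℕ.m≤n*m x r)) ⟩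
        (a * t + pj * r) * x + r * x
          ≡⟨ regroup′ (a * t) pj r x ⟩
        (a * t + suc pj * r) * x
          ≡⟨ cong (λ i → (a * t + i * r) * x) suc-pj ⟩
        (a * t + j * r) * x
          ≤⟨ ℕ.m≤m+n _ _ ⟩
        (a * t + j * r) * x + j * (j ∸ 1) ∎
        where
        t = suc s
        x = n ∸ j
        pj = ℕ.pred j
        suc-pj : suc pj ≡ j
        suc-pj = ℕ.suc-pred j {{ℕ.>-nonZero (ℕ.≤-trans (s≤s z≤n) b<j)}}
        b∸1≤k : b ∸ 1 ≤ k
        b∸1≤k = ℕ.≤-trans (ℕ.m∸n≤m b 1) (ℕ.≤-trans b≤index j≤k)
        n∸b≤ : n ∸ b ≤ x + k
        n∸b≤ = ℕ.≤-trans (ℕ.m∸n≤m n b) (ℕ.≤-trans (ℕ.m≤n+m∸n n j)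
                 (ℕ.≤-trans (ℕ.≤-reflexive (ℕ.+-comm j x)) (ℕ.+-monoʳ-≤ x j≤k)))
        slack : k * (w * t) + k * (k + r * k) + k * w * D * (r * t) ≤ x
        slack = ℕ.≤-trans (ℕ.≤-reflexive (sym (ℕ.m+n∸m≡n k _))) (ℕ.∸-mono N≤n j≤k)
        regroup : ∀ x k a t p r y → (x + k) * a * t + p * (k + r * (x + k)) + y ≡
                  (a * t + p * r) * x + (k * (a * t) + p * (k + r * k) + y)
        regroup = solve-∀
        regroup′ : ∀ y p r x → (y + p * r) * x + r * x ≡ (y + (1 + p) * r) * x
        regroup′ = solve-∀

    hub-list-large : ∀ {b} (hub : Fin b → Fin n) → (∀ i → hub i ∈ hubs) →
                     ∀ i → ∣ ⊥ {n} ∣ + k + w ≤ ∣ through (hub i) ∣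
    hub-list-large hub hub∈ i rewrite ∣⊥∣≡0 n = ∈⟪⟫⁻ hub? (hub∈ i)

    bound-or-forest : Forest H d ⊎ (∃[ j ] length H * (r * (r ∸ 1)) ≤ scaledTerm r d n j)
    bound-or-forest with ∣ hubs ∣ ℕ.≤? k
    ... | yes few with greedy-with-hubs w d d*r≤w few (enum hubs) (enum-injective hubs) ⊥ (λ _ → ∉⊥)
                         (hub-list-large (enum hubs) (enum-∈ hubs))
    ...   | inj₁ T  = inj₁ (ForestAvoiding.forest T)
    ...   | inj₂ st = inj₂ (Stuck.index st′ , stuck-bound st′)
      where
      hubs≡ : ⊥ ∪ ⋃ᶠ (⁅_⁆ ∘ enum hubs) ≡ hubs
      hubs≡ = trans (∪-identityˡ _) (⊆-antisym
        (λ v∈ → let a , v∈a = ∈⋃ᶠ⁻ (⁅_⁆ ∘ enum hubs) v∈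
                in subst (_∈ hubs) (sym (x∈⁅y⁆⇒x≡y _ v∈a)) (enum-∈ hubs a))
        (λ v∈ → let a , eq = enum-surjective v∈
                in ∈⋃ᶠ (⁅_⁆ ∘ enum hubs) a (subst (_∈ ⁅ enum hubs a ⁆) eq (x∈⁅x⁆ _))))
      st′ = subst (λ W → Stuck w (∣ hubs ∣) W d) hubs≡ st
    bound-or-forest | no many with choose hubs (ℕ.<⇒≤ (ℕ.≰⇒> many))
    ... | hub , hub-inj , hub∈ with greedy-with-hubs w d d*r≤w ℕ.≤-refl hub hub-inj ⊥ (λ _ → ∉⊥) (hub-list-large hub hub∈)
    ...   | inj₁ T  = inj₁ (ForestAvoiding.forest T)
    -- With `k` hubs no star is sought elsewhere, so there is no index at which to fail.
    ...   | inj₂ st = contradiction (Stuck.b≤index st) (ℕ.<⇒≱ (Fin.toℕ<n (Stuck.index st)))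

  upper : (∀ i → 1 ≤ d i) → ∀ {n} → N ≤ n → (H : Hypergraph n) → Uniform r H → Linear H → ¬ (starForest⁺ r d ⊑ H) →
          ∃[ j ] length H * (r * (r ∸ 1)) ≤ scaledTerm r d n j
  upper d≥1 N≤n H unif lin free with bound-or-forest N≤n H unif (Linear⇒IsLinear lin)
  ... | inj₁ T     = contradiction (forest⇒starForest⁺⊑ H s d≥1 unif (Linear⇒IsLinear lin) T) free
  ... | inj₂ bound = bound

-- Lower bound

-- The equation is (x - y) (b - c) = 0, written without subtraction.
exchange⇒≡ : ∀ x y b c → x * b + y * c ≡ y * b + x * c → b ≢ c → x ≡ y
exchange⇒≡ x y b c eq b≢c = [ ordered x y b c eq b≢c , sym ∘ ordered y x b c (sym eq) b≢c ]′ (ℕ.≤-total x y)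
  where
  lhs : ∀ x δ b c → x * b + x * c + δ * b ≡ (x + δ) * b + x * c
  lhs = solve-∀
  rhs : ∀ x δ b c → x * b + (x + δ) * c ≡ x * b + x * c + δ * c
  rhs = solve-∀
  ordered : ∀ x y b c → x * b + y * c ≡ y * b + x * c → b ≢ c → x ≤ y → x ≡ y
  ordered x y b c eq b≢c x≤y with y ∸ x | ℕ.m+[n∸m]≡n x≤y
  ... | zero  | refl = sym (ℕ.+-identityʳ x)
  ... | suc δ | refl = contradiction (ℕ.*-cancelˡ-≡ b c (suc δ) (ℕ.+-cancelˡ-≡ (x * b + x * c) _ _
      (trans (lhs x (suc δ) b c) (trans (sym eq) (rhs x (suc δ) b c))))) b≢c

-- Here `x`, `y` are slopes, `a`, `a′` intercepts and `b`, `c` two columns. Adding one equation to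
-- the reverse of the other cancels the intercepts.
two-lines-meet-once : ∀ x y a a′ b c → a + x * b ≡ a′ + y * b → a + x * c ≡ a′ + y * c → b ≢ c → x ≡ y
two-lines-meet-once x y a a′ b c eq-b eq-c = exchange⇒≡ x y b c (ℕ.+-cancelˡ-≡ (a + a′) _ _ (begin
  a + a′ + (x * b + y * c)       ≡⟨ shuffle a a′ (x * b) (y * c) ⟩
  (a + x * b) + (a′ + y * c)     ≡⟨ cong₂ _+_ eq-b (sym eq-c) ⟩
  (a′ + y * b) + (a + x * c)     ≡⟨ shuffle a′ a (y * b) (x * c) ⟨
  a′ + a + (y * b + x * c)       ≡⟨ cong (_+ (y * b + x * c)) (ℕ.+-comm a′ a) ⟩
  a + a′ + (y * b + x * c)       ∎))
  where
  open ≡-Reasoning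
  shuffle : ∀ a b c d → a + b + (c + d) ≡ (a + c) + (b + d)
  shuffle = solve-∀

-- Besides p hubs the vertices form a grid with r (r - 1) columns. Edges are
-- pieces of lines in the grid, cut into pieces of r - 1 columns for the first
-- p slopes, the hub with the number of the slope being added to each piece,
-- and into pieces of r columns for the last q slopes.
module Construction (s p q M : ℕ) {n} (size≤n : p + (2+ s * suc s) * (M + (p + q) * (2+ s * suc s)) ≤ n) where

  -- `L` columns can be cut both into pieces of r - 1 and into pieces of r. Lines start in one of
  -- `M` rows and rise by at most `(p + q) * L`, so with `Y` rows they stay inside the grid.
  r t L Y : ℕ
  r = 2+ s
  t = suc s
  L = r * t
  Y = M + (p + q) * L

  Position : Set
  Position = Fin p ⊎ (Fin L × Fin Y)

  vertex : Position → Fin n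
  vertex (inj₁ x)       = Fin.inject≤ (x ↑ˡ (L * Y)) size≤n
  vertex (inj₂ (c , y)) = Fin.inject≤ (p ↑ʳ Fin.combine c y) size≤n

  position : Fin (p + L * Y) → Position
  position v = Sum.map₂ (Fin.remQuot {L} Y) (Fin.splitAt p v)

  vertex-injective : Injective _≡_ _≡_ vertex
  vertex-injective {u} {v} eq = trans (sym (position-code u))
    (trans (cong position (Fin.inject≤-injective size≤n size≤n _ _ (trans (sym (vertex≡ u)) (trans eq (vertex≡ v)))))
      (position-code v))
    where
    code : Position → Fin (p + L * Y)
    code (inj₁ x)       = x ↑ˡ (L * Y)
    code (inj₂ (c , y)) = p ↑ʳ Fin.combine c y
    vertex≡ : ∀ v → vertex v ≡ Fin.inject≤ (code v) size≤n
    vertex≡ (inj₁ x) = refl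
    vertex≡ (inj₂ _) = refl
    position-code : ∀ v → position (code v) ≡ v
    position-code (inj₁ x) rewrite Fin.splitAt-↑ˡ p x (L * Y) = refl
    position-code (inj₂ (c , y)) rewrite Fin.splitAt-↑ʳ p (L * Y) (Fin.combine c y) =
      cong inj₂ (Fin.remQuot-combine c y)

  data Index : Set where
    hub-edge   : Fin p → Fin r → Fin M → Index
    plain-edge : Fin q → Fin t → Fin M → Index

  slope : Index → Fin (p + q)
  slope (hub-edge x _ _)   = x ↑ˡ q
  slope (plain-edge x _ _) = p ↑ʳ x

  offset : Index → Fin M
  offset (hub-edge _ _ a)   = a
  offset (plain-edge _ _ a) = a

  row : Fin (p + q) → Fin M → Fin L → Fin Y
  row σ a c = Fin.fromℕ< {toℕ a + toℕ σ * toℕ c} (ℕ.+-mono-<-≤ (Fin.toℕ<n a)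
    (ℕ.*-mono-≤ (ℕ.<⇒≤ (Fin.toℕ<n σ)) (ℕ.<⇒≤ (Fin.toℕ<n c))))

  row-≡ : ∀ {σ σ′ a a′ c} → row σ a c ≡ row σ′ a′ c → toℕ a + toℕ σ * toℕ c ≡ toℕ a′ + toℕ σ′ * toℕ c
  row-≡ eq = trans (sym (Fin.toℕ-fromℕ< _)) (trans (cong toℕ eq) (Fin.toℕ-fromℕ< _))

  swap : Fin (t * r) → Fin L
  swap = Fin.cast (ℕ.*-comm t r)

  point : Index → Fin r → Position
  point (hub-edge x g a)   zero    = inj₁ x
  point (hub-edge x g a)   (suc u) = let c = Fin.combine g u in inj₂ (c , row (x ↑ˡ q) a c)
  point (plain-edge x g a) u       = let c = swap (Fin.combine g u) in inj₂ (c , row (p ↑ʳ x) a c)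

  swap-injective : Injective _≡_ _≡_ swap
  swap-injective {c} {c′} eq = Fin.toℕ-injective
    (trans (sym (Fin.toℕ-cast _ c)) (trans (cong toℕ eq) (Fin.toℕ-cast _ c′)))

  point-injective : ∀ e → Injective _≡_ _≡_ (point e)
  point-injective (hub-edge x g a) {zero}  {zero}  eq = refl
  point-injective (hub-edge x g a) {suc u} {suc v} eq =
    cong suc (Fin.combine-injectiveʳ g u g v (cong proj₁ (inj₂-injective eq)))
  point-injective (plain-edge x g a) {u} {v} eq =
    Fin.combine-injectiveʳ g u g v (swap-injective (cong proj₁ (inj₂-injective eq)))

  On : Index → Position → Set
  On e v = ∃[ u ] point e u ≡ v

  on-hub : ∀ {e x y g a} → e ≡ hub-edge x g a → On e (inj₁ y) → y ≡ x
  on-hub refl (zero , refl) = refl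

  Piece : Index → Fin L → Set
  Piece (hub-edge _ g _)   c = Σ[ u ∈ Fin t ] Fin.combine g u ≡ c
  Piece (plain-edge _ g _) c = Σ[ u ∈ Fin r ] swap (Fin.combine g u) ≡ c

  on-grid : ∀ e {c y} → On e (inj₂ (c , y)) → y ≡ row (slope e) (offset e) c × Piece e c
  on-grid (hub-edge x g a)   (suc u , refl) = refl , u , refl
  on-grid (plain-edge x g a) (u , refl)     = refl , u , refl

  same-line⇒≡ : ∀ e f {c} → slope e ≡ slope f → offset e ≡ offset f → Piece e c → Piece f c → e ≡ f
  same-line⇒≡ (hub-edge x g a) (hub-edge y h b) σ≡ refl (u , eq) (v , eq′)
    with refl ← Fin.↑ˡ-injective q x y σ≡ | refl ← Fin.combine-injectiveˡ g u h v (trans eq (sym eq′)) = refl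
  same-line⇒≡ (plain-edge x g a) (plain-edge y h b) σ≡ refl (u , eq) (v , eq′)
    with refl ← Fin.↑ʳ-injective p x y σ≡
       | refl ← Fin.combine-injectiveˡ g u h v (swap-injective (trans eq (sym eq′))) = refl
  same-line⇒≡ (hub-edge x g a) (plain-edge y h b) σ≡ _ _ _ =
    case trans (sym (Fin.splitAt-↑ˡ p x q)) (trans (cong (Fin.splitAt p) σ≡) (Fin.splitAt-↑ʳ p q y)) of λ ()
  same-line⇒≡ (plain-edge x g a) (hub-edge y h b) σ≡ _ _ _ =
    case trans (sym (Fin.splitAt-↑ˡ p y q)) (trans (cong (Fin.splitAt p) (sym σ≡)) (Fin.splitAt-↑ʳ p q x)) of λ ()

  same-slope⇒≡ : ∀ e f → slope e ≡ slope f → ∀ {c y} → On e (inj₂ (c , y)) → On f (inj₂ (c , y)) → e ≡ f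
  same-slope⇒≡ e f σ≡ {c} on-e on-f =
    let y≡e , in-e = on-grid e on-e
        y≡f , in-f = on-grid f on-f
        eq = row-≡ {slope e} {slope f} {offset e} {offset f} (trans (sym y≡e) y≡f)
        a≡ = ℕ.+-cancelʳ-≡ _ _ _ (trans eq (cong (λ σ → toℕ (offset f) + toℕ σ * toℕ c) (sym σ≡)))
    in same-line⇒≡ e f σ≡ (Fin.toℕ-injective a≡) in-e in-f

  -- No edge contains two hubs or two points of a column. A common hub forces equal slopes, and so
  -- do common points in two columns; pieces of equal slope with a common grid point coincide.
  linear : ∀ e f {u v} → u ≢ v → On e u → On e v → On f u → On f v → e ≡ f
  linear (hub-edge x g a) (hub-edge y h b) {inj₁ z} {inj₁ w} u≢v eu ev fu fv =
    contradiction (cong inj₁ (trans (on-hub refl eu) (sym (on-hub refl ev)))) u≢v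
  linear (hub-edge x g a) (hub-edge y h b) {inj₁ z} {inj₂ w} u≢v eu ev fu fv =
    same-slope⇒≡ _ _ (cong (_↑ˡ q) (trans (sym (on-hub refl eu)) (on-hub refl fu))) ev fv
  linear (hub-edge x g a) (hub-edge y h b) {inj₂ w} {inj₁ z} u≢v eu ev fu fv =
    same-slope⇒≡ _ _ (cong (_↑ˡ q) (trans (sym (on-hub refl ev)) (on-hub refl fv))) eu fu
  linear (plain-edge x g a) f {inj₁ z} {v} u≢v (_ , ()) ev fu fv
  linear (plain-edge x g a) f {inj₂ w} {inj₁ z} u≢v eu (_ , ()) fu fv
  linear (hub-edge x g a) (plain-edge y h b) {inj₁ z} {v} u≢v eu ev (_ , ()) fv
  linear (hub-edge x g a) (plain-edge y h b) {inj₂ w} {inj₁ z} u≢v eu ev fu (_ , ())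
  linear e f {inj₂ (c , y)} {inj₂ (c′ , y′)} u≢v eu ev fu fv with c Fin.≟ c′
  ... | yes refl = contradiction (cong (λ y → inj₂ (c , y)) (trans (proj₁ (on-grid e eu)) (sym (proj₁ (on-grid e ev))))) u≢v
  ... | no c≢c′ = same-slope⇒≡ e f (Fin.toℕ-injective (two-lines-meet-once _ _ (toℕ (offset e)) (toℕ (offset f)) (toℕ c) (toℕ c′)
      (row-≡ {slope e} {slope f} {offset e} {offset f} (trans (sym (proj₁ (on-grid e eu))) (proj₁ (on-grid f fu))))
      (row-≡ {slope e} {slope f} {offset e} {offset f} (trans (sym (proj₁ (on-grid e ev))) (proj₁ (on-grid f fv))))
      (c≢c′ ∘ Fin.toℕ-injective))) eu fu

  edgeSet : Index → Subset n
  edgeSet e = image (vertex ∘ point e)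

  ∈edgeSet : ∀ e {v} → v ∈ edgeSet e → ∃[ u ] vertex u ≡ v × On e u
  ∈edgeSet e v∈ = let u , eq = ∈-image⁻ _ v∈ in point e u , eq , u , refl

  m : ℕ
  m = p * (r * M) + q * (t * M)

  decode : Fin m → Index
  decode j with Fin.splitAt (p * (r * M)) j
  ... | inj₁ j′ = let x , j″ = Fin.remQuot (r * M) j′; g , a = Fin.remQuot {r} M j″ in hub-edge x g a
  ... | inj₂ j′ = let x , j″ = Fin.remQuot (t * M) j′; g , a = Fin.remQuot {t} M j″ in plain-edge x g a

  encode : Index → Fin m
  encode (hub-edge x g a)   = Fin.combine x (Fin.combine g a) ↑ˡ (q * (t * M))
  encode (plain-edge x g a) = (p * (r * M)) ↑ʳ Fin.combine x (Fin.combine g a)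

  encode-decode : ∀ j → encode (decode j) ≡ j
  encode-decode j with Fin.splitAt (p * (r * M)) j in eq
  ... | inj₁ j′ = trans (cong (_↑ˡ (q * (t * M))) (trans
        (cong (Fin.combine (proj₁ (Fin.remQuot {p} (r * M) j′))) (Fin.combine-remQuot {r} M _)) (Fin.combine-remQuot {p} (r * M) j′)))
        (Fin.splitAt⁻¹-↑ˡ eq)
  ... | inj₂ j′ = trans (cong ((p * (r * M)) ↑ʳ_) (trans
        (cong (Fin.combine (proj₁ (Fin.remQuot {q} (t * M) j′))) (Fin.combine-remQuot {t} M _)) (Fin.combine-remQuot {q} (t * M) j′)))
        (Fin.splitAt⁻¹-↑ʳ eq)

  decode-injective : Injective _≡_ _≡_ decode
  decode-injective {i} {j} eq = trans (sym (encode-decode i)) (trans (cong encode eq) (encode-decode j))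

  E : Fin m → Subset n
  E = edgeSet ∘ decode

  E-uniform : IsUniform r E
  E-uniform j = ∣image∣≡ _ (point-injective (decode j) ∘ vertex-injective)

  E-linear : IsLinear E
  E-linear {i} {j} {u} {v} u≢v ui vi uj vj =
    let u₁ , eq₁ , on₁ = ∈edgeSet (decode i) ui
        v₁ , eq₂ , on₂ = ∈edgeSet (decode i) vi
        u₂ , eq₃ , on₃ = ∈edgeSet (decode j) uj
        v₂ , eq₄ , on₄ = ∈edgeSet (decode j) vj
    in decode-injective (linear (decode i) (decode j) {u₁} {v₁}
         (λ u₁≡v₁ → u≢v (trans (sym eq₁) (trans (cong vertex u₁≡v₁) eq₂))) on₁ on₂
         (subst (On (decode j)) (vertex-injective (trans eq₃ (sym eq₁))) on₃)
         (subst (On (decode j)) (vertex-injective (trans eq₄ (sym eq₂))) on₄))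

  H : Hypergraph n
  H = List.tabulate E

  hub∈ : ∀ x g a → vertex (inj₁ x) ∈ edgeSet (hub-edge x g a)
  hub∈ x g a = ∈-image⁺ _ zero

  -- Only the first p + 1 stars are considered. Each has an edge through one of the `p` hubs, so two
  -- of them meet in a hub.
  H-free : ∀ {k} {d : Fin k → ℕ} → p < k → (∀ i → toℕ i ≤ p → suc q ≤ d i) → ¬ Forest H d
  H-free {k} {d} p<k q<d T =
    let x , y , x<y , eq = Fin.pigeonhole ℕ.≤-refl (λ x → proj₁ (hub-of x))
        a , p∈ = proj₂ (hub-of x)
        b , q∈ = proj₂ (hub-of y)
    in Forest.disjoint T {star-index x} {star-index y}
         (λ eq → ℕ.<⇒≢ x<y (trans (sym (Fin.toℕ-inject≤ x p<k)) (trans (cong toℕ eq) (Fin.toℕ-inject≤ y p<k))))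
         a b p∈ (subst (λ z → vertex (inj₁ z) ∈ edge T (star-index y) b) (sym eq) q∈)
    where
    star-index : Fin (suc p) → Fin k
    star-index x = Fin.inject≤ x p<k

    index : ∀ i a → ∃[ j ] edge T i a ≡ E j
    index i a = ∈-tabulate⁻ (Forest.edge∈H T i a)

    IsHub : Index → Set
    IsHub e = ∃[ x ] ∃[ g ] ∃[ a ] e ≡ hub-edge x g a

    hub? : ∀ e → Dec (IsHub e)
    hub? (hub-edge x g a)   = yes (x , g , a , refl)
    hub? (plain-edge x g a) = no λ ()

    plain : ∀ e → ¬ IsHub e → ∃[ x ] slope e ≡ p ↑ʳ x
    plain (hub-edge x g a)   ¬hub = contradiction (x , g , a , refl) ¬hub
    plain (plain-edge x g a) ¬hub = x , refl

    -- Of q + 1 plain edges two have the same slope. Both contain the centre, which is then a grid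
    -- point, so they are the same piece of one line.
    no-plain-star : ∀ i → suc q ≤ d i → ¬ (∀ a → ¬ IsHub (decode (proj₁ (index i a))))
    no-plain-star i q<dᵢ ¬hub =
      let a , b , a<b , eq = Fin.pigeonhole q<dᵢ (λ a → proj₁ (plain (e a) (¬hub a)))
      in Fin.<⇒≢ a<b (Forest.injective T i (trans (proj₂ (index i a)) (trans (cong edgeSet (coincide a b
           (trans (proj₂ (plain (e a) (¬hub a))) (trans (cong (p ↑ʳ_) eq) (sym (proj₂ (plain (e b) (¬hub b)))))) ))
           (sym (proj₂ (index i b))))))
      where
      e : Fin (d i) → Index
      e a = decode (proj₁ (index i a))
      coincide : ∀ a b → slope (e a) ≡ slope (e b) → e a ≡ e b
      coincide a b σ≡ =
        let u , eq  , on-a = ∈edgeSet (e a) (subst (center T i ∈_) (proj₂ (index i a)) (Forest.center∈ T i a))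
            v , eq′ , on-b = ∈edgeSet (e b) (subst (center T i ∈_) (proj₂ (index i b)) (Forest.center∈ T i b))
        in go (e a) (e b) (¬hub a) σ≡ u on-a (subst (On (e b)) (vertex-injective (trans eq′ (sym eq))) on-b)
        where
        go : ∀ e f → ¬ IsHub e → slope e ≡ slope f → ∀ u → On e u → On f u → e ≡ f
        go e f ¬hub-e σ≡ (inj₂ _) on-e on-f = same-slope⇒≡ e f σ≡ on-e on-f
        go (hub-edge x g a) f ¬hub-e σ≡ (inj₁ _) on-e on-f = contradiction (x , g , a , refl) ¬hub-e
        go (plain-edge x g a) f ¬hub-e σ≡ (inj₁ _) (_ , ()) on-f

    hub-of : ∀ x → ∃[ z ] ∃[ a ] vertex (inj₁ z) ∈ edge T (star-index x) a
    hub-of x with Fin.any? (λ a → hub? (decode (proj₁ (index (star-index x) a))))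
    ... | no none = contradiction (λ a hub → none (a , hub)) (no-plain-star (star-index x)
          (q<d (star-index x) (subst (_≤ p) (sym (Fin.toℕ-inject≤ x p<k)) (ℕ.≤-pred (Fin.toℕ<n x)))))
    ... | yes (a , z , g , o , eq) = z , a , subst (vertex (inj₁ z) ∈_)
          (sym (trans (proj₂ (index (star-index x) a)) (cong edgeSet eq))) (hub∈ z g o)

  H-attains : ∀ {k} {d : Fin k → ℕ} → p < k → (∀ i → toℕ i ≤ p → suc q ≤ d i) → Attains r n (starForest⁺ r d) m
  H-attains p<k q<d = H , List.length-tabulate E
    , AllPairs.tabulate⁺ (λ i≢j → i≢j ∘ uniform-linear⇒injective E-uniform E-linear)
    , All.tabulate⁺ E-uniform
    , AllPairs.tabulate⁺ (λ {i} {j} i≢j → ℕ.≮⇒≥ λ 2≤ →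
        let e , inj , e∈ = choose (E i ∩ E j) 2≤
        in i≢j (E-linear (λ e₀≡e₁ → case inj e₀≡e₁ of λ ())
             (proj₁ (x∈p∩q⁻ _ _ (e∈ zero))) (proj₁ (x∈p∩q⁻ _ _ (e∈ (suc zero))))
             (proj₂ (x∈p∩q⁻ (E i) _ (e∈ zero))) (proj₂ (x∈p∩q⁻ (E i) _ (e∈ (suc zero))))))
    , H-free p<k q<d ∘ starForest⁺⊑⇒forest s

-- Existence of the extremal number

isImage? : ∀ {m n} (φ : Fin m → Fin n) e h → Dec (IsImage φ e h)
isImage? φ e h = Fin.all? λ x →
  let hit? = Fin.any? (λ v → v ∈? e ×-dec φ v Fin.≟ x)
  in map′ (uncurry mk⇔) (λ eq → Equivalence.to eq , Equivalence.from eq)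
       ((x ∈? h →-dec hit?) ×-dec (hit? →-dec x ∈? h))

injective? : ∀ {m n} (φ : Fin m → Fin n) → Dec (Injective _≡_ _≡_ φ)
injective? φ = map′ (λ inj {v} {w} → inj v w) (λ inj v w → inj {v} {w})
  (Fin.all? λ v → Fin.all? λ w → φ v Fin.≟ φ w →-dec v Fin.≟ w)

-- Maps are searched through their codes in a finite set. Decoding returns a map only up to
-- pointwise equality, hence `isImage-cong`.
_⊑?_ : ∀ {m n} (F : Hypergraph m) (H : Hypergraph n) → Dec (F ⊑ H)
F ⊑? H = map′
  (λ (i , emb) → Fin.finToFun i , emb)
  (λ (φ , inj , emb) →
    let φ≗ = λ v → sym (Fin.finToFun-funToFin φ v)
    in Fin.funToFin φ , (λ eq → inj (trans (φ≗ _) (trans eq (sym (φ≗ _))))) ,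
       All.map (Any.map (isImage-cong φ≗)) emb)
  (Fin.any? λ i → injective? (Fin.finToFun i) ×-dec
    All.all? (λ e → Any.any? (isImage? (Fin.finToFun i) e) H) F)

anyHypergraph? : ∀ {n} m {P : Hypergraph n → Set} → Decidable P → Dec (∃[ H ] length H ≡ m × P H)
anyHypergraph? zero P? = map′ (λ P[] → [] , refl , P[]) (λ { ([] , _ , P[]) → P[] }) (P? [])
anyHypergraph? (suc m) P? = map′
  (λ (e , H , eq , PH) → e ∷ H , cong suc eq , PH)
  (λ { (e ∷ H , eq , PH) → e , H , ℕ.suc-injective eq , PH })
  (anySubset? λ e → anyHypergraph? m (P? ∘ (e ∷_)))

attains? : ∀ r n {v} (F : Hypergraph v) m → Dec (Attains r n F m)
attains? r n F m = anyHypergraph? m λ H →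
  allPairs? (λ e f → ¬? (Vec.≡-dec Bool._≟_ e f)) H ×-dec
  All.all? (λ e → ∣ e ∣ ℕ.≟ r) H ×-dec
  allPairs? (λ e f → ∣ e ∩ f ∣ ℕ.≤? 1) H ×-dec
  ¬? (F ⊑? H)

simple⇒length≤ : ∀ {n} (H : Hypergraph n) → Simple H → length H ≤ 2 ^ n
simple⇒length≤ {n} H simple = Fin.injective⇒≤ {f = code ∘ List.lookup H} λ {i} {j} eq → case i Fin.≟ j of λ
  { (yes i≡j) → i≡j
  ; (no  i≢j) → contradiction (code-injective eq) (lookup-AllPairs (λ e≢f → e≢f ∘ sym) simple i≢j) }
  where
  bit : Bool → Fin 2
  bit false = zero
  bit true  = suc zero
  bit-injective : Injective _≡_ _≡_ bit
  bit-injective {false} {false} _ = refl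
  bit-injective {true}  {true}  _ = refl
  code : Subset n → Fin (2 ^ n)
  code S = Fin.funToFin (bit ∘ lookup S)
  code-injective : Injective _≡_ _≡_ code
  code-injective {S} {T} eq = trans (sym (Vec.tabulate∘lookup S)) (trans (Vec.tabulate-cong same) (Vec.tabulate∘lookup T))
    where
    same : ∀ v → lookup S v ≡ lookup T v
    same v = bit-injective (trans (sym (Fin.finToFun-funToFin (bit ∘ lookup S) v))
      (trans (cong (λ i → Fin.finToFun i v) eq) (Fin.finToFun-funToFin (bit ∘ lookup T) v)))

greatest : ∀ {P : ℕ → Set} → Decidable P → P 0 → ∀ b → (∀ m → P m → m ≤ b) →
           Σ[ m ∈ ℕ ] P m × (∀ m′ → P m′ → m′ ≤ m)
greatest P? P0 zero    bounded = 0 , P0 , bounded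
greatest P? P0 (suc b) bounded with P? (suc b)
... | yes P1+b = suc b , P1+b , bounded
... | no ¬P1+b = greatest P? P0 b λ m Pm → ℕ.≤-pred (ℕ.≤∧≢⇒< (bounded m Pm) λ { refl → ¬P1+b Pm })

-- All conditions are decidable, the empty hypergraph attains 0, and at most 2 ^ n distinct edges
-- exist, so the maximum is found by searching downwards.
exLin-exists : ∀ r n {v} (F : Hypergraph v) → ¬ (F ⊑ [] {A = Subset n}) → Σ[ m ∈ ℕ ] IsExLin r n F m
exLin-exists r n F F⋢∅ = greatest (attains? r n F) ([] , refl , [] , [] , [] , F⋢∅) (2 ^ n)
  λ { m (H , refl , simple , _) → simple⇒length≤ H simple }

starForest⁺⋢∅ : ∀ s {k n} {d : Fin (suc k) → ℕ} → 1 ≤ d zero → ¬ (starForest⁺ (2+ s) d ⊑ [] {A = Subset n})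
starForest⁺⋢∅ s {d = d} d₀≥1 emb = case Forest.edge∈H (starForest⁺⊑⇒forest s {d = d} emb) zero (Fin.fromℕ< d₀≥1) of λ ()

-- Rational bounds and asymptotics

toℚᵘ-/ : ∀ p d → toℚᵘ (p / suc d) ≃ mkℚᵘ p d
toℚᵘ-/ p d = ℚ.toℚᵘ-fromℚᵘ (mkℚᵘ p d)

ℕ→ℚ-homo-+ : ∀ a b → ℕ→ℚ (a + b) ≡ ℕ→ℚ a ℚ.+ ℕ→ℚ b
ℕ→ℚ-homo-+ a b = ℚ.toℚᵘ-injective (begin
  toℚᵘ (ℕ→ℚ (a + b))                     ≈⟨ toℚᵘ-/ (ℤ.+ (a + b)) 0 ⟩
  mkℚᵘ (ℤ.+ (a + b)) 0                     ≈⟨ *≡* (cong (ℤ._* ℤ.+ 1) (sym (cong₂ ℤ._+_ (ℤ.*-identityʳ (ℤ.+ a)) (ℤ.*-identityʳ (ℤ.+ b))))) ⟩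
  mkℚᵘ (ℤ.+ a) 0 ℚᵘ.+ mkℚᵘ (ℤ.+ b) 0         ≈⟨ ℚᵘ.+-cong (toℚᵘ-/ (ℤ.+ a) 0) (toℚᵘ-/ (ℤ.+ b) 0) ⟨
  toℚᵘ (ℕ→ℚ a) ℚᵘ.+ toℚᵘ (ℕ→ℚ b)         ≈⟨ ℚ.toℚᵘ-homo-+ (ℕ→ℚ a) (ℕ→ℚ b) ⟨
  toℚᵘ (ℕ→ℚ a ℚ.+ ℕ→ℚ b)                 ∎)
  where open ℚᵘ.≃-Reasoning

ℕ→ℚ-homo-* : ∀ a b → ℕ→ℚ (a * b) ≡ ℕ→ℚ a ℚ.* ℕ→ℚ b
ℕ→ℚ-homo-* a b = ℚ.toℚᵘ-injective (begin
  toℚᵘ (ℕ→ℚ (a * b))                     ≈⟨ toℚᵘ-/ (ℤ.+ (a * b)) 0 ⟩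
  mkℚᵘ (ℤ.+ (a * b)) 0                     ≈⟨ *≡* (cong (ℤ._* ℤ.+ 1) (ℤ.pos-* a b)) ⟩
  mkℚᵘ (ℤ.+ a) 0 ℚᵘ.* mkℚᵘ (ℤ.+ b) 0         ≈⟨ ℚᵘ.*-cong (toℚᵘ-/ (ℤ.+ a) 0) (toℚᵘ-/ (ℤ.+ b) 0) ⟨
  toℚᵘ (ℕ→ℚ a) ℚᵘ.* toℚᵘ (ℕ→ℚ b)         ≈⟨ ℚ.toℚᵘ-homo-* (ℕ→ℚ a) (ℕ→ℚ b) ⟨
  toℚᵘ (ℕ→ℚ a ℚ.* ℕ→ℚ b)                 ∎)
  where open ℚᵘ.≃-Reasoning

ℕ→ℚ-mono-≤ : ∀ {a b} → a ≤ b → ℕ→ℚ a ℚ.≤ ℕ→ℚ b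
ℕ→ℚ-mono-≤ {a} {b} a≤b = ℚ.toℚᵘ-cancel-≤ (begin
  toℚᵘ (ℕ→ℚ a)  ≃⟨ toℚᵘ-/ (ℤ.+ a) 0 ⟩
  mkℚᵘ (ℤ.+ a) 0  ≤⟨ *≤* (ℤ.*-monoʳ-≤-nonNeg (ℤ.+ 1) (+≤+ a≤b)) ⟩
  mkℚᵘ (ℤ.+ b) 0  ≃⟨ toℚᵘ-/ (ℤ.+ b) 0 ⟨
  toℚᵘ (ℕ→ℚ b)  ∎)
  where open ℚᵘ.≤-Reasoning

/-* : ∀ a d .{{_ : NonZero d}} → (ℤ.+ a / d) ℚ.* ℕ→ℚ d ≡ ℕ→ℚ a
/-* a (suc d) = ℚ.toℚᵘ-injective (begin
  toℚᵘ ((ℤ.+ a / suc d) ℚ.* ℕ→ℚ (suc d))         ≈⟨ ℚ.toℚᵘ-homo-* (ℤ.+ a / suc d) (ℕ→ℚ (suc d)) ⟩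
  toℚᵘ (ℤ.+ a / suc d) ℚᵘ.* toℚᵘ (ℕ→ℚ (suc d))   ≈⟨ ℚᵘ.*-cong (toℚᵘ-/ (ℤ.+ a) d) (toℚᵘ-/ (ℤ.+ suc d) 0) ⟩
  mkℚᵘ (ℤ.+ a) d ℚᵘ.* mkℚᵘ (ℤ.+ suc d) 0           ≈⟨ *≡* (ℤ.*-assoc (ℤ.+ a) (ℤ.+ suc d) (ℤ.+ 1)) ⟩
  mkℚᵘ (ℤ.+ a) 0                                 ≈⟨ toℚᵘ-/ (ℤ.+ a) 0 ⟨
  toℚᵘ (ℕ→ℚ a)                                 ∎)
  where open ℚᵘ.≃-Reasoning

2*[nC2]≡n*[n∸1] : ∀ n → 2 * (n C 2) ≡ n * (n ∸ 1)
2*[nC2]≡n*[n∸1] zero          = refl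
2*[nC2]≡n*[n∸1] (suc zero)    = refl
2*[nC2]≡n*[n∸1] (suc (suc n)) = begin
  2 * (2+ n C 2)                       ≡⟨ cong (2 *_) (nCk+nC[k+1]≡[n+1]C[k+1] (suc n) 1) ⟨
  2 * (suc n C 1 + suc n C 2)          ≡⟨ cong (λ x → 2 * (x + suc n C 2)) (nC1≡n (suc n)) ⟩
  2 * (suc n + suc n C 2)              ≡⟨ ℕ.*-distribˡ-+ 2 (suc n) _ ⟩
  2 * suc n + 2 * (suc n C 2)          ≡⟨ cong (λ x → 2 * suc n + x) (2*[nC2]≡n*[n∸1] (suc n)) ⟩
  2 * suc n + suc n * n                ≡⟨ regroup n ⟩
  2+ n * suc n                         ∎
  where
  open ≡-Reasoning
  regroup : ∀ n → 2 * (1 + n) + (1 + n) * n ≡ (2 + n) * (1 + n)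
  regroup = solve-∀

-- The hypotheses turn both integer differences in `term` into truncated ones, and r (r - 1) = 2 (r
-- C 2) clears all three denominators.
term*≡scaledTerm : ∀ s {k} (d : Fin k → ℕ) n i → 1 ≤ d i → toℕ i ≤ n →
  term (2+ s) d n i ℚ.* ℕ→ℚ (2+ s * suc s) ≡ ℕ→ℚ (scaledTerm (2+ s) d n i)
term*≡scaledTerm s d n i d≥1 i≤n = begin
  term r d n i ℚ.* Q (r * t)
    ≡⟨ cong₂ (λ x y → ((x / r ℚ.+ ℤ.+ p / t) ℚ.* (y / 1) ℚ.+ binom) ℚ.* Q (r * t)) (ℤ.⊖-≥ d≥1) (ℤ.⊖-≥ i≤n) ⟩
  ((ℤ.+ a / r ℚ.+ ℤ.+ p / t) ℚ.* Q x ℚ.+ binom) ℚ.* Q (r * t)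
    ≡⟨ ℚ.*-distribʳ-+ (Q (r * t)) ((ℤ.+ a / r ℚ.+ ℤ.+ p / t) ℚ.* Q x) binom ⟩
  (ℤ.+ a / r ℚ.+ ℤ.+ p / t) ℚ.* Q x ℚ.* Q (r * t) ℚ.+ binom ℚ.* Q (r * t)
    ≡⟨ cong₂ ℚ._+_ linear quadratic ⟩
  Q ((a * t + p * r) * x) ℚ.+ Q (p * (p ∸ 1))
    ≡⟨ ℕ→ℚ-homo-+ ((a * t + p * r) * x) (p * (p ∸ 1)) ⟨
  Q ((a * t + p * r) * x + p * (p ∸ 1)) ∎
  where
  open ≡-Reasoning
  instance
    _ = rC2-nonZero (2+ s)
  Q = ℕ→ℚ
  r = 2+ s
  t = suc s
  a = d i ∸ 1
  p = toℕ i
  x = n ∸ p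
  binom = ℤ.+ (p C 2) / (r C 2)

  distribute : ∀ A B X R T → (A ℚ.+ B) ℚ.* X ℚ.* (R ℚ.* T) ≡ ((A ℚ.* R) ℚ.* T ℚ.+ (B ℚ.* T) ℚ.* R) ℚ.* X
  distribute = solve 5 (λ A B X R T → (A :+ B) :* X :* (R :* T) := ((A :* R) :* T :+ (B :* T) :* R) :* X) refl
    where open +-*-Solver

  linear : (ℤ.+ a / r ℚ.+ ℤ.+ p / t) ℚ.* Q x ℚ.* Q (r * t) ≡ Q ((a * t + p * r) * x)
  linear = begin
    (ℤ.+ a / r ℚ.+ ℤ.+ p / t) ℚ.* Q x ℚ.* Q (r * t)
      ≡⟨ cong ((ℤ.+ a / r ℚ.+ ℤ.+ p / t) ℚ.* Q x ℚ.*_) (ℕ→ℚ-homo-* r t) ⟩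
    (ℤ.+ a / r ℚ.+ ℤ.+ p / t) ℚ.* Q x ℚ.* (Q r ℚ.* Q t)
      ≡⟨ distribute (ℤ.+ a / r) (ℤ.+ p / t) (Q x) (Q r) (Q t) ⟩
    ((ℤ.+ a / r ℚ.* Q r) ℚ.* Q t ℚ.+ (ℤ.+ p / t ℚ.* Q t) ℚ.* Q r) ℚ.* Q x
      ≡⟨ cong₂ (λ A B → (A ℚ.* Q t ℚ.+ B ℚ.* Q r) ℚ.* Q x) (/-* a r) (/-* p t) ⟩
    (Q a ℚ.* Q t ℚ.+ Q p ℚ.* Q r) ℚ.* Q x
      ≡⟨ cong (ℚ._* Q x) (cong₂ ℚ._+_ (ℕ→ℚ-homo-* a t) (ℕ→ℚ-homo-* p r)) ⟨
    (Q (a * t) ℚ.+ Q (p * r)) ℚ.* Q x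
      ≡⟨ cong (ℚ._* Q x) (ℕ→ℚ-homo-+ (a * t) (p * r)) ⟨
    Q (a * t + p * r) ℚ.* Q x
      ≡⟨ ℕ→ℚ-homo-* (a * t + p * r) x ⟨
    Q ((a * t + p * r) * x) ∎

  quadratic : binom ℚ.* Q (r * t) ≡ Q (p * (p ∸ 1))
  quadratic = begin
    binom ℚ.* Q (r * t)               ≡⟨ cong (λ y → binom ℚ.* Q y) (trans (sym (2*[nC2]≡n*[n∸1] r)) (ℕ.*-comm 2 (r C 2))) ⟩
    binom ℚ.* Q ((r C 2) * 2)           ≡⟨ cong (binom ℚ.*_) (ℕ→ℚ-homo-* (r C 2) 2) ⟩
    binom ℚ.* (Q (r C 2) ℚ.* Q 2)     ≡⟨ ℚ.*-assoc binom (Q (r C 2)) (Q 2) ⟨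
    binom ℚ.* Q (r C 2) ℚ.* Q 2       ≡⟨ cong (ℚ._* Q 2) (/-* (p C 2) (r C 2)) ⟩
    Q (p C 2) ℚ.* Q 2                  ≡⟨ ℕ→ℚ-homo-* (p C 2) 2 ⟨
    Q ((p C 2) * 2)                      ≡⟨ cong Q (trans (ℕ.*-comm (p C 2) 2) (2*[nC2]≡n*[n∸1] p)) ⟩
    Q (p * (p ∸ 1))                    ∎

≤maximum : ∀ {k} (f : Fin (suc k) → ℚ) i → f i ℚ.≤ maximum f
≤maximum {zero}  f zero    = ℚ.≤-refl
≤maximum {suc k} f zero    = ℚ.p≤p⊔q (f zero) _
≤maximum {suc k} f (suc i) = ℚ.≤-trans (≤maximum (f ∘ suc) i) (ℚ.p≤q⊔p (f zero) _)

maximum≤ : ∀ {k} (f : Fin (suc k) → ℚ) {x} → (∀ i → f i ℚ.≤ x) → maximum f ℚ.≤ x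
maximum≤ {zero}  f f≤x = f≤x zero
maximum≤ {suc k} f f≤x = ℚ.⊔-lub (f≤x zero) (maximum≤ (f ∘ suc) (f≤x ∘ suc))

∣x-y∣≤c : ∀ {x y c} → x ℚ.≤ y → y ℚ.≤ x ℚ.+ c → ℚ.∣ x ℚ.- y ∣ ℚ.≤ c
∣x-y∣≤c {x} {y} {c} x≤y y≤x+c = begin
  ℚ.∣ x ℚ.- y ∣          ≡⟨ ℚ.∣-p∣≡∣p∣ (x ℚ.- y) ⟨
  ℚ.∣ ℚ.- (x ℚ.- y) ∣    ≡⟨ cong ℚ.∣_∣ (flip-sign x y) ⟩
  ℚ.∣ y ℚ.- x ∣          ≡⟨ ℚ.0≤p⇒∣p∣≡p 0≤y-x ⟩
  y ℚ.- x                ≤⟨ ℚ.+-monoˡ-≤ (ℚ.- x) y≤x+c ⟩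
  x ℚ.+ c ℚ.- x          ≡⟨ cancel x c ⟩
  c                      ∎
  where
  open ℚ.≤-Reasoning
  flip-sign : ∀ x y → ℚ.- (x ℚ.- y) ≡ y ℚ.- x
  flip-sign = solve 2 (λ x y → :- (x :- y) := y :- x) refl
    where open +-*-Solver
  cancel : ∀ x c → x ℚ.+ c ℚ.- x ≡ c
  cancel = solve 2 (λ x c → x :+ c :- x := c) refl
    where open +-*-Solver
  0≤y-x : 0ℚ ℚ.≤ y ℚ.- x
  0≤y-x = subst (ℚ._≤ y ℚ.- x) (ℚ.+-inverseʳ x) (ℚ.+-monoˡ-≤ (ℚ.- x) x≤y)

p≤∣p∣ : ∀ p → p ℚ.≤ ℚ.∣ p ∣
p≤∣p∣ p with ℚ.≤-total 0ℚ p
... | inj₁ 0≤p = ℚ.≤-reflexive (sym (ℚ.0≤p⇒∣p∣≡p 0≤p))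
... | inj₂ p≤0 = ℚ.≤-trans p≤0 (ℚ.0≤∣p∣ p)

-- A positive rational times its denominator is its numerator, which is at least 1.
reciprocal-bound : ∀ {ε} → 0ℚ ℚ.< ε → Σ[ e ∈ ℕ ] 1ℚ ℚ.≤ ε ℚ.* ℕ→ℚ e
reciprocal-bound {mkℚ (ℤ.+ zero)  e _} (*<* (ℤ.+<+ ()))
reciprocal-bound {mkℚ +[1+ a ] e c} 0<ε = suc e , (begin
  ℕ→ℚ 1                                       ≤⟨ ℕ→ℚ-mono-≤ (s≤s (z≤n {a})) ⟩
  ℕ→ℚ (suc a)                                 ≡⟨ /-* (suc a) (suc e) ⟨
  (+[1+ a ] / suc e) ℚ.* ℕ→ℚ (suc e)          ≡⟨ cong (ℚ._* ℕ→ℚ (suc e)) (ℚ.↥p/↧p≡p (mkℚ +[1+ a ] e c)) ⟩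
  mkℚ +[1+ a ] e c ℚ.* ℕ→ℚ (suc e)            ∎)
  where open ℚ.≤-Reasoning
reciprocal-bound {mkℚ ℤ.-[1+ a ] e _} (*<* ())

-- Sharpness up to an additive constant

module _ (s : ℕ) {k} (d : Fin (suc k) → ℕ) (d≥1 : ∀ i → 1 ≤ d i) (d-antitone : ∀ i j → i Fin.≤ j → d j ≤ d i)
  (ex : ℕ → ℕ) (isEx : ∀ n → IsExLin (2+ s) n (starForest⁺ (2+ s) d) (ex n)) where

  private
    r t L : ℕ
    r = 2+ s
    t = suc s
    L = r * t

    coefficient : Fin (suc k) → ℕ
    coefficient i = (d i ∸ 1) * t + toℕ i * r

    -- The grid spends `L * (slopes i * L)` vertices on the rise of its lines and leaves fewer than
    -- `L` over; `lossAt i` is what these contribute to the scaled term, plus the constant part of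
    -- that term. From `thresholdAt i` on the grid fits, possibly with `M = 0`. Sums over all i
    -- serve every term at once.
    slopes lossAt thresholdAt : Fin (suc k) → ℕ
    slopes i = toℕ i + (d i ∸ 1)
    lossAt i = coefficient i * (L * (slopes i * L) + L) + toℕ i * (toℕ i ∸ 1)
    thresholdAt i = toℕ i + L * (slopes i * L)

    loss threshold : ℕ
    loss = sum lossAt
    threshold = suc k + sum thresholdAt

    i≤threshold : ∀ i → toℕ i ≤ threshold
    i≤threshold i = ℕ.≤-trans (ℕ.<⇒≤ (Fin.toℕ<n i)) (ℕ.m≤m+n (suc k) _)

    lower : ∀ n → threshold ≤ n → ∀ i → scaledTerm r d n i ≤ (ex n + loss) * L
    lower n N≤n i = begin
      scaledTerm r d n i
        ≤⟨ ℕ.+-monoˡ-≤ (p * (p ∸ 1)) (ℕ.*-monoʳ-≤ c x≤) ⟩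
      c * (L * M + (L * (S * L) + L)) + p * (p ∸ 1)
        ≡⟨ regroup c (L * M) (L * (S * L) + L) (p * (p ∸ 1)) ⟩
      c * (L * M) + lossAt i
        ≡⟨ cong (_+ lossAt i) (edges q t p r M L) ⟩
      m * L + lossAt i
        ≤⟨ ℕ.+-mono-≤ (ℕ.*-monoˡ-≤ L (proj₂ (isEx n) m attained)) (ℕ.≤-trans (≤∑ lossAt i) (ℕ.m≤m*n loss L)) ⟩
      ex n * L + loss * L
        ≡⟨ ℕ.*-distribʳ-+ L (ex n) loss ⟨
      (ex n + loss) * L ∎
      where
      open ℕ.≤-Reasoning
      p = toℕ i
      q = d i ∸ 1
      S = slopes i
      c = coefficient i
      x = n ∸ p
      -- There is room for `x / L` rows, of which `S * L` are kept for the rise of the lines.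
      M = x ℕ./ L ∸ S * L
      m = p * (r * M) + q * (t * M)

      thresholdAt≤n : p + L * (S * L) ≤ n
      thresholdAt≤n = ℕ.≤-trans (≤∑ thresholdAt i) (ℕ.≤-trans (ℕ.m≤n+m _ (suc k)) N≤n)

      p≤n : p ≤ n
      p≤n = ℕ.≤-trans (ℕ.m≤m+n p _) thresholdAt≤n

      S*L≤x/L : S * L ≤ x ℕ./ L
      S*L≤x/L = begin
        S * L                  ≡⟨ ℕ.m*n/n≡m (S * L) L ⟨
        S * L * L ℕ./ L        ≡⟨ cong (ℕ._/ L) (ℕ.*-comm (S * L) L) ⟩
        L * (S * L) ℕ./ L      ≡⟨ cong (ℕ._/ L) (ℕ.m+n∸m≡n p _) ⟨
        (p + L * (S * L) ∸ p) ℕ./ L ≤⟨ ℕ./-monoˡ-≤ L (ℕ.∸-monoˡ-≤ p thresholdAt≤n) ⟩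
        x ℕ./ L                ∎

      M+S*L : M + S * L ≡ x ℕ./ L
      M+S*L = ℕ.m∸n+n≡m S*L≤x/L

      size≤n : p + L * (M + S * L) ≤ n
      size≤n = begin
        p + L * (M + S * L)  ≡⟨ cong (λ y → p + L * y) M+S*L ⟩
        p + L * (x ℕ./ L)    ≡⟨ cong (λ y → p + y) (ℕ.*-comm L (x ℕ./ L)) ⟩
        p + x ℕ./ L * L      ≤⟨ ℕ.+-monoʳ-≤ p (ℕ.m/n*n≤m x L) ⟩
        p + x                ≡⟨ ℕ.m+[n∸m]≡n p≤n ⟩
        n                    ∎

      x≤ : x ≤ L * M + (L * (S * L) + L)
      x≤ = begin
        x                             ≡⟨ ℕ.m≡m%n+[m/n]*n x L ⟩
        x ℕ.% L + x ℕ./ L * L         ≤⟨ ℕ.+-monoˡ-≤ _ (ℕ.<⇒≤ (ℕ.m%n<n x L)) ⟩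
        L + x ℕ./ L * L               ≡⟨ cong (λ y → L + y * L) M+S*L ⟨
        L + (M + S * L) * L           ≡⟨ rearrange L M (S * L) ⟩
        L * M + (L * (S * L) + L)     ∎
        where
        rearrange : ∀ l m y → l + (m + y) * l ≡ l * m + (l * y + l)
        rearrange = solve-∀

      attained : Attains r n (starForest⁺ r d) m
      attained = Construction.H-attains s p q M size≤n (Fin.toℕ<n i)
        (λ j j≤i → ℕ.≤-trans (ℕ.≤-reflexive (ℕ.m+[n∸m]≡n (d≥1 i))) (d-antitone j i j≤i))

      regroup : ∀ c x y z → c * (x + y) + z ≡ c * x + (c * y + z)
      regroup = solve-∀
      edges : ∀ q t p r M L → (q * t + p * r) * (L * M) ≡ (p * (r * M) + q * (t * M)) * L
      edges = solve-∀

    scaled-term : ∀ {n} i → threshold ≤ n → term r d n i ℚ.* ℕ→ℚ L ≡ ℕ→ℚ (scaledTerm r d n i)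
    scaled-term {n} i N≤n = term*≡scaledTerm s d n i (d≥1 i) (ℕ.≤-trans (i≤threshold i) N≤n)

    attains⇒≤bound : ∀ {n m} → Upper.N s d + threshold ≤ n → Attains r n (starForest⁺ r d) m → ℕ→ℚ m ℚ.≤ bound r d n
    attains⇒≤bound {n} N≤n (H , refl , _ , unif , lin , free) =
      let i , m≤ = Upper.upper s d d≥1 (ℕ.≤-trans (ℕ.m≤m+n (Upper.N s d) threshold) N≤n) H unif lin free
      in ℚ.≤-trans (ℚ.*-cancelʳ-≤-pos (ℕ→ℚ L) {{ℚ.normalize-pos L 1}} (begin
        ℕ→ℚ (length H) ℚ.* ℕ→ℚ L     ≡⟨ ℕ→ℚ-homo-* (length H) L ⟨
        ℕ→ℚ (length H * L)           ≤⟨ ℕ→ℚ-mono-≤ m≤ ⟩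
        ℕ→ℚ (scaledTerm r d n i)     ≡⟨ scaled-term i (ℕ.≤-trans (ℕ.m≤n+m threshold (Upper.N s d)) N≤n) ⟨
        term r d n i ℚ.* ℕ→ℚ L       ∎))
      (≤maximum (term r d n) i)
      where open ℚ.≤-Reasoning

    upper-bound : ∀ n → Upper.N s d + threshold ≤ n → ℕ→ℚ (ex n) ℚ.≤ bound r d n
    upper-bound n N≤n = attains⇒≤bound N≤n (proj₁ (isEx n))

    lower-bound : ∀ n → threshold ≤ n → bound r d n ℚ.≤ ℕ→ℚ (ex n) ℚ.+ ℕ→ℚ loss
    lower-bound n N≤n = maximum≤ (term r d n) λ i → ℚ.*-cancelʳ-≤-pos (ℕ→ℚ L) {{ℚ.normalize-pos L 1}} (begin
      term r d n i ℚ.* ℕ→ℚ L                  ≡⟨ scaled-term i N≤n ⟩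
      ℕ→ℚ (scaledTerm r d n i)                ≤⟨ ℕ→ℚ-mono-≤ (lower n N≤n i) ⟩
      ℕ→ℚ ((ex n + loss) * L)                 ≡⟨ ℕ→ℚ-homo-* (ex n + loss) L ⟩
      ℕ→ℚ (ex n + loss) ℚ.* ℕ→ℚ L             ≡⟨ cong (ℚ._* ℕ→ℚ L) (ℕ→ℚ-homo-+ (ex n) loss) ⟩
      (ℕ→ℚ (ex n) ℚ.+ ℕ→ℚ loss) ℚ.* ℕ→ℚ L     ∎)
      where open ℚ.≤-Reasoning

    scaledTerm-large : ∀ i → 1 ≤ coefficient i → ∀ {n} c → toℕ i + c ≤ n → c ≤ scaledTerm r d n i
    scaledTerm-large i c≥1 {n} c N≤n = begin
      c                              ≡⟨ ℕ.m+n∸m≡n (toℕ i) c ⟨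
      toℕ i + c ∸ toℕ i              ≤⟨ ℕ.∸-monoˡ-≤ (toℕ i) N≤n ⟩
      n ∸ toℕ i                      ≤⟨ ℕ.m≤n*m (n ∸ toℕ i) (coefficient i) {{ℕ.>-nonZero c≥1}} ⟩
      coefficient i * (n ∸ toℕ i)    ≤⟨ ℕ.m≤m+n _ _ ⟩
      scaledTerm r d n i             ∎
      where open ℕ.≤-Reasoning

    -- A term with positive coefficient grows at least like (n - i) / L. For the n considered it is
    -- therefore at least loss · e, and ε e ≥ 1.
    loss≤ε*bound : ∀ i → 1 ≤ coefficient i → ∀ ε → 0ℚ ℚ.< ε → ∀ e → 1ℚ ℚ.≤ ε ℚ.* ℕ→ℚ e → ∀ n →
      threshold ≤ n → toℕ i + loss * L * e ≤ n → ℕ→ℚ loss ℚ.≤ ε ℚ.* ℚ.∣ bound r d n ∣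
    loss≤ε*bound i c≥1 ε 0<ε e 1≤ε*e n N₁≤n N₂≤n = ℚ.≤-trans
      (ℚ.*-cancelʳ-≤-pos {ℕ→ℚ loss} {ε ℚ.* term r d n i} (ℕ→ℚ L) {{ℚ.normalize-pos L 1}} (begin
        ℕ→ℚ loss ℚ.* ℕ→ℚ L                       ≡⟨ ℕ→ℚ-homo-* loss L ⟨
        ℕ→ℚ (loss * L)                           ≡⟨ ℚ.*-identityʳ (ℕ→ℚ (loss * L)) ⟨
        ℕ→ℚ (loss * L) ℚ.* 1ℚ                    ≤⟨ ℚ.*-monoˡ-≤-nonNeg (ℕ→ℚ (loss * L)) {{ℚ.normalize-nonNeg (loss * L) 1}} 1≤ε*e ⟩
        ℕ→ℚ (loss * L) ℚ.* (ε ℚ.* ℕ→ℚ e)         ≡⟨ shuffle (ℕ→ℚ (loss * L)) ε (ℕ→ℚ e) ⟩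
        ε ℚ.* (ℕ→ℚ (loss * L) ℚ.* ℕ→ℚ e)         ≡⟨ cong (ε ℚ.*_) (ℕ→ℚ-homo-* (loss * L) e) ⟨
        ε ℚ.* ℕ→ℚ (loss * L * e)                 ≤⟨ ℚ.*-monoˡ-≤-nonNeg ε {{ε-nonNeg}} (ℕ→ℚ-mono-≤ (scaledTerm-large i c≥1 (loss * L * e) N₂≤n)) ⟩
        ε ℚ.* ℕ→ℚ (scaledTerm r d n i)           ≡⟨ cong (ε ℚ.*_) (scaled-term i N₁≤n) ⟨
        ε ℚ.* (term r d n i ℚ.* ℕ→ℚ L)           ≡⟨ ℚ.*-assoc ε (term r d n i) (ℕ→ℚ L) ⟨
        ε ℚ.* term r d n i ℚ.* ℕ→ℚ L             ∎))
      (ℚ.*-monoˡ-≤-nonNeg ε {{ε-nonNeg}} (ℚ.≤-trans (≤maximum (term r d n) i) (p≤∣p∣ (bound r d n))))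
      where
      open ℚ.≤-Reasoning
      ε-nonNeg : ℚ.NonNegative ε
      ε-nonNeg = ℚ.nonNegative (ℚ.<⇒≤ 0<ε)
      shuffle : ∀ x y z → x ℚ.* (y ℚ.* z) ≡ y ℚ.* (x ℚ.* z)
      shuffle = solve 3 (λ x y z → x :* (y :* z) := y :* (x :* z)) refl
        where open +-*-Solver

    growing : ∀ i → 1 ≤ coefficient i → (λ n → ℕ→ℚ (ex n)) ∼ bound r d
    growing i c≥1 ε 0<ε = Upper.N s d + threshold + (toℕ i + loss * L * e) , close
      where
      e = proj₁ (reciprocal-bound 0<ε)
      close : ∀ n → Upper.N s d + threshold + (toℕ i + loss * L * e) ≤ n →
              ℚ.∣ ℕ→ℚ (ex n) ℚ.- bound r d n ∣ ℚ.≤ ε ℚ.* ℚ.∣ bound r d n ∣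
      close n N≤n = ℚ.≤-trans (∣x-y∣≤c {ℕ→ℚ (ex n)} {bound r d n} {ℕ→ℚ loss} (upper-bound n N₁≤n) (lower-bound n N₂≤n))
        (loss≤ε*bound i c≥1 ε 0<ε e (proj₂ (reciprocal-bound 0<ε)) n N₂≤n
          (ℕ.≤-trans (ℕ.m≤n+m (toℕ i + loss * L * e) (Upper.N s d + threshold)) N≤n))
        where
        N₁≤n : Upper.N s d + threshold ≤ n
        N₁≤n = ℕ.≤-trans (ℕ.m≤m+n (Upper.N s d + threshold) (toℕ i + loss * L * e)) N≤n
        N₂≤n : threshold ≤ n
        N₂≤n = ℕ.≤-trans (ℕ.m≤n+m threshold (Upper.N s d)) N₁≤n

    -- If all coefficients vanish, then k = 1 and d₁ = 1, and the bound is zero.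
    vanishing : (∀ i → ¬ 1 ≤ coefficient i) → (λ n → ℕ→ℚ (ex n)) ∼ bound r d
    vanishing c≱1 ε 0<ε = Upper.N s d + threshold , close
      where
      scaledTerm≡0 : ∀ n i → scaledTerm r d n i ≡ 0
      scaledTerm≡0 n i = cong₂ (λ c p → c * (n ∸ toℕ i) + p * (toℕ i ∸ 1)) c≡0
        (ℕ.m*n≡0⇒m≡0 (toℕ i) r (ℕ.m+n≡0⇒n≡0 ((d i ∸ 1) * t) c≡0))
        where
        c≡0 : coefficient i ≡ 0
        c≡0 = ℕ.n<1⇒n≡0 (ℕ.≰⇒> (c≱1 i))
      bound≤0 : ∀ n → threshold ≤ n → bound r d n ℚ.≤ 0ℚ
      bound≤0 n N≤n = maximum≤ (term r d n) λ i → ℚ.*-cancelʳ-≤-pos {term r d n i} {0ℚ} (ℕ→ℚ L) {{ℚ.normalize-pos L 1}}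
        (ℚ.≤-reflexive (trans (scaled-term i N≤n) (trans (cong ℕ→ℚ (scaledTerm≡0 n i)) (sym (ℚ.*-zeroˡ (ℕ→ℚ L))))))
      close : ∀ n → Upper.N s d + threshold ≤ n →
              ℚ.∣ ℕ→ℚ (ex n) ℚ.- bound r d n ∣ ℚ.≤ ε ℚ.* ℚ.∣ bound r d n ∣
      close n N≤n = begin
        ℚ.∣ ℕ→ℚ (ex n) ℚ.- bound r d n ∣    ≤⟨ ∣x-y∣≤c {ℕ→ℚ (ex n)} {bound r d n} {0ℚ} (upper-bound n N≤n) bound≤ex ⟩
        0ℚ                                  ≡⟨ ℚ.*-zeroʳ ε ⟨
        ε ℚ.* 0ℚ                            ≤⟨ ℚ.*-monoˡ-≤-nonNeg ε {{ℚ.nonNegative (ℚ.<⇒≤ 0<ε)}} (ℚ.0≤∣p∣ (bound r d n)) ⟩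
        ε ℚ.* ℚ.∣ bound r d n ∣             ∎
        where
        open ℚ.≤-Reasoning
        bound≤ex : bound r d n ℚ.≤ ℕ→ℚ (ex n) ℚ.+ 0ℚ
        bound≤ex = begin
          bound r d n           ≤⟨ bound≤0 n (ℕ.≤-trans (ℕ.m≤n+m threshold (Upper.N s d)) N≤n) ⟩
          0ℚ                    ≤⟨ ℕ→ℚ-mono-≤ (z≤n {ex n}) ⟩
          ℕ→ℚ (ex n)            ≡⟨ ℚ.+-identityʳ (ℕ→ℚ (ex n)) ⟨
          ℕ→ℚ (ex n) ℚ.+ 0ℚ     ∎

    asymptotic : (λ n → ℕ→ℚ (ex n)) ∼ bound r d
    asymptotic = decide (Fin.any? (λ i → 1 ℕ.≤? coefficient i))
      where
      decide : Dec (∃[ i ] 1 ≤ coefficient i) → (λ n → ℕ→ℚ (ex n)) ∼ bound r d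
      decide (yes (i , c≥1)) = growing i c≥1
      decide (no none)       = vanishing (λ i c≥1 → none (i , c≥1))

  bound-and-asymptotics : (∃[ N ] ∀ n → N ≤ n → ℕ→ℚ (ex n) ℚ.≤ bound r d n) × (λ n → ℕ→ℚ (ex n)) ∼ bound r d
  bound-and-asymptotics = (Upper.N s d + threshold , upper-bound) , asymptotic

theorem1p7 : ∀ k .{{_ : NonZero k}} r .{{_ : NonTrivial r}} (d : Fin k → ℕ) →
    (∀ i → 1 ≤ d i) →
    (∀ i j → i Fin.≤ j → d j ≤ d i) →
    Σ[ ex ∈ (ℕ → ℕ) ]
      (∀ n → IsExLin r n (starForest⁺ r d) (ex n)) ×
      (∃[ N ] ∀ n → N ≤ n → ℕ→ℚ (ex n) ℚ.≤ bound r d n) ×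
      (λ n → ℕ→ℚ (ex n)) ∼ bound r d
theorem1p7 (suc k) (2+ s) d d≥1 d-antitone =
  proj₁ ∘ existence , proj₂ ∘ existence ,
  bound-and-asymptotics s d d≥1 d-antitone (proj₁ ∘ existence) (proj₂ ∘ existence)
  where
  existence : ∀ n → Σ[ m ∈ ℕ ] IsExLin (2+ s) n (starForest⁺ (2+ s) d) m
  existence n = exLin-exists (2+ s) n (starForest⁺ (2+ s) d) (starForest⁺⋢∅ s {d = d} (d≥1 zero))
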